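{- For each $m \in \{259, 304, 308, 372, 394, 483, 497\}$ there is no positive integer $n$ with $p^2(n,5) = m$; that is, no positive integer can be expressed as the sum of exactly $5$ positive squares in exactly $m$ ways.
   Context: $p^2(n,j)$ denotes the number of ways to write $n$ as a sum of exactly $j$ positive squares, up to order of summands. -}

module Defs where

open import Data.Nat using (ℕ; zero; suc; _+_; _*_; _∸_; _≤?_)
open import Relation.Nullary using (yes; no)

-- sqParts n j b : number of ways to write n = k₁² + … + kⱼ² with
-- b ≥ k₁ ≥ k₂ ≥ … ≥ kⱼ ≥ 1 (i.e. multisets of j positive squares,
-- listed in non-increasing order of the bases, all bases ≤ b).
-- Recursion on j, choosing the largest base k ∈ {1,…,b} first.
sqParts : ℕ → ℕ → ℕ → ℕ
sqParts zero    zero    b = 1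
sqParts (suc n) zero    b = 0
sqParts n       (suc j) zero    = 0
sqParts n       (suc j) (suc b) with suc b * suc b ≤? n
... | yes _ = sqParts (n ∸ (suc b * suc b)) j (suc b) + sqParts n (suc j) b
... | no  _ = sqParts n (suc j) b

-- p²(n,j): number of ways to write n as a sum of exactly j positive
-- squares, up to order of summands. Every base k satisfies k ≤ k² ≤ n,
-- so bounding bases by n loses nothing.
p2 : ℕ → ℕ → ℕ
p2 n j = sqParts n j n

{-# OPTIONS --safe #-}
module Submission where

open import Defs
open import Data.Bool using (Bool; true; false; _∧_; not; if_then_else_)
open import Data.Bool.Properties using (T-≡)
open import Data.Fin using (Fin; toℕ; fromℕ<; splitAt; _↑ˡ_; _↑ʳ_)
open import Data.Fin.Properties as Fin
  using (pigeonhole; toℕ<n; toℕ-injective; fromℕ<-injective; splitAt⁻¹-↑ˡ; splitAt⁻¹-↑ʳ)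
open import Data.Integer as ℤ using (ℤ; +_; -[1+_]; ∣_∣)
import Data.Integer.Properties as ℤ
import Data.Integer.Tactic.RingSolver as ℤSolver
open import Data.List using (List; _∷_; [])
open import Data.List.Membership.Propositional using (_∈_)
import Data.List.Relation.Unary.All as All
open All using (All; _∷_; [])
open import Data.Nat
open import Data.Nat.Divisibility as Div using (divides; ∣⇒≤; m%n≡0⇒n∣m; n∣m*n)
open import Data.Nat.DivMod
open import Data.Nat.Induction using (<-rec)
open import Data.Nat.ListAction using (product)
open import Data.Nat.Primality
  using (Prime; euclidsLemma; prime⇒irreducible; prime⇒nonTrivial)
open import Data.Nat.Primality.Factorisation using (factorise; module PrimeFactorisation)
open import Data.Nat.Properties
open import Data.List.Membership.DecPropositional _≟_ using (_∈?_)
open import Data.Nat.Tactic.RingSolver using (solve-∀)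
open import Data.Product using (∃; ∃₂; _×_; _,_; proj₁; proj₂)
open import Data.Sum using (_⊎_; inj₁; inj₂)
open import Data.Unit using (⊤; tt)
open import Function using (_∘_; module Equivalence)
open import Relation.Binary using (tri<; tri≈; tri>)
open import Relation.Binary.PropositionalEquality
open import Relation.Nullary using (yes; no; ¬_; contradiction)
open import Relation.Nullary.Decidable using (⌊_⌋; toWitness)

-- All n with p²(n,5) ≤ 497 are small, because five squares leave much room.
--
-- For n > 169 · 6474² take s with 169 (s + 498)² < n ≤ 169 (s + 499)². For each of the
-- 498 values s < t ≤ s + 498, Lagrange's theorem writes n − (13 t)² as at most four
-- positive squares, and (13 t)² splits into the missing number of them since
-- 13² = 12² + 5² = 12² + 4² + 3² = 10² + 8² + 2² + 1². The largest part recovers t.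
--
-- For smaller n the counts are read off generating functions evaluated at a power X of
-- two (Kronecker substitution), whose base-X digits are the coefficients. Digits of
-- (Σ X^(k²))⁴ show that odd m in [25200, 393216) have more than 24 · 497 ordered
-- representations by four positive squares, so p²(m,4) ≥ 498; each n ≥ 65536 in the
-- remaining range is k² plus such an m with m < (k + 1)². For n < 65536 the exact
-- generating function of p²(n,5) is scanned.

-- Counting functions

Seq : Set
Seq = ℕ → ℕ

δ : Seq
δ zero    = 1
δ (suc _) = 0

-- Coefficients of x ^ s · F, where f lists those of F.
shift : ℕ → Seq → Seq
shift zero    f n       = f n
shift (suc s) f zero    = 0
shift (suc s) f (suc n) = shift s f n

shift-+ˡ : ∀ s f n → shift s f (s + n) ≡ f n
shift-+ˡ zero    f n = refl
shift-+ˡ (suc s) f n = shift-+ˡ s f n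

shift-< : ∀ {s n} f → n < s → shift s f n ≡ 0
shift-< {suc s} {zero}  f _         = refl
shift-< {suc s} {suc n} f (s≤s n<s) = shift-< f n<s

shift-mono : ∀ s {f g} → (∀ n → f n ≤ g n) → ∀ n → shift s f n ≤ shift s g n
shift-mono zero    f≤g n       = f≤g n
shift-mono (suc s) f≤g zero    = z≤n
shift-mono (suc s) f≤g (suc n) = shift-mono s f≤g n

shift-≤ : ∀ s {f M} → (∀ n → f n ≤ M) → ∀ n → shift s f n ≤ M
shift-≤ zero    f≤M n       = f≤M n
shift-≤ (suc s) f≤M zero    = z≤n
shift-≤ (suc s) f≤M (suc n) = shift-≤ s f≤M n

shift-add : ∀ s f g n → shift s (λ i → f i + g i) n ≡ shift s f n + shift s g n
shift-add zero    f g n       = refl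
shift-add (suc s) f g zero    = refl
shift-add (suc s) f g (suc n) = shift-add s f g n

shift-scale : ∀ s c f n → shift s (λ i → c * f i) n ≡ c * shift s f n
shift-scale zero    c f n       = refl
shift-scale (suc s) c f zero    = sym (*-zeroʳ c)
shift-scale (suc s) c f (suc n) = shift-scale s c f n

shift-zero : ∀ s n → shift s (λ _ → 0) n ≡ 0
shift-zero zero    n       = refl
shift-zero (suc s) zero    = refl
shift-zero (suc s) (suc n) = shift-zero s n

shift-shift : ∀ s t f n → shift s (shift t f) n ≡ shift (s + t) f n
shift-shift zero    t f n       = refl
shift-shift (suc s) t f zero    = refl
shift-shift (suc s) t f (suc n) = shift-shift s t f n

shift-comm : ∀ s t f n → shift s (shift t f) n ≡ shift t (shift s f) n
shift-comm s t f n = begin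
  shift s (shift t f) n ≡⟨ shift-shift s t f n ⟩
  shift (s + t) f n     ≡⟨ cong (λ u → shift u f n) (+-comm s t) ⟩
  shift (t + s) f n     ≡⟨ shift-shift t s f n ⟨
  shift t (shift s f) n ∎
  where open ≡-Reasoning

-- Partitions into squares of bounded bases

parts : ℕ → ℕ → Seq
parts j b n = sqParts n j b

parts-zero : ∀ b n → parts 0 b n ≡ δ n
parts-zero b zero    = refl
parts-zero b (suc n) = refl

parts-base : ∀ j n → parts (suc j) 0 n ≡ 0
parts-base j zero    = refl
parts-base j (suc n) = refl

-- The recursion read as a generating function identity: `shift` vanishes below `suc b * suc b`,
-- which absorbs the comparison in `sqParts`.
parts-suc : ∀ j b n →
  parts (suc j) (suc b) n ≡ shift (suc b * suc b) (parts j (suc b)) n + parts (suc j) b n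
parts-suc j b zero = refl
parts-suc j b n@(suc _) with suc b * suc b ≤? n
... | yes k²≤n = cong (_+ parts (suc j) b n)
  (trans (sym (shift-+ˡ (suc b * suc b) (parts j (suc b)) (n ∸ suc b * suc b)))
         (cong (shift (suc b * suc b) (parts j (suc b))) (m+[n∸m]≡n k²≤n)))
... | no  k²≰n = cong (_+ parts (suc j) b n)
  (sym (shift-< (parts j (suc b)) (≰⇒> k²≰n)))

-- `j` counts the parts other than the largest, whose base is exactly `k` when `k` is positive.
withLargest : ℕ → ℕ → Seq
withLargest j k = shift (k * k) (parts j k)

parts-mono : ∀ j {b c} → b ≤ c → ∀ n → parts j b n ≤ parts j c n
parts-mono j {b} b≤c n = go (≤⇒≤′ b≤c)
  where
  step : ∀ j c n → parts j c n ≤ parts j (suc c) n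
  step zero    c n = ≤-reflexive (trans (parts-zero c n) (sym (parts-zero (suc c) n)))
  step (suc j) c n = ≤-trans (m≤n+m _ _) (≤-reflexive (sym (parts-suc j c n)))
  go : ∀ {c} → b ≤′ c → parts j b n ≤ parts j c n
  go (≤′-reflexive refl) = ≤-refl
  go (≤′-step b≤′c)      = ≤-trans (go b≤′c) (step j _ n)

-- The counts on the left concern disjoint sets of partitions: those with largest base exactly `b`,
-- and those with all bases at most `a < b`.
withLargest+parts≤parts : ∀ j {a b} n → a < b → withLargest j b n + parts (suc j) a n ≤ parts (suc j) b n
withLargest+parts≤parts j {a} {suc b} n (s≤s a≤b) = begin
  withLargest j (suc b) n + parts (suc j) a n ≤⟨ +-monoʳ-≤ (withLargest j (suc b) n) (parts-mono (suc j) a≤b n) ⟩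
  withLargest j (suc b) n + parts (suc j) b n ≡⟨ parts-suc j b n ⟨
  parts (suc j) (suc b) n                     ∎
  where open ≤-Reasoning

withLargest≤parts : ∀ j {b c} n → 1 ≤ b → b ≤ c → withLargest j b n ≤ parts (suc j) c n
withLargest≤parts j {b} {c} n 1≤b b≤c = begin
  withLargest j b n                     ≤⟨ m≤m+n _ _ ⟩
  withLargest j b n + parts (suc j) 0 n ≤⟨ withLargest+parts≤parts j n 1≤b ⟩
  parts (suc j) b n                     ≤⟨ parts-mono (suc j) b≤c n ⟩
  parts (suc j) c n                     ∎
  where open ≤-Reasoning

parts-stable : ∀ j {b c n} → b ≤ c → n < suc b * suc b → parts (suc j) c n ≡ parts (suc j) b n
parts-stable j {b} {n = n} b≤c n<b² = go (≤⇒≤′ b≤c)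
  where
  go : ∀ {c} → b ≤′ c → parts (suc j) c n ≡ parts (suc j) b n
  go (≤′-reflexive refl) = refl
  go (≤′-step {c} b≤′c)  = begin
    parts (suc j) (suc c) n                     ≡⟨ parts-suc j c n ⟩
    withLargest j (suc c) n + parts (suc j) c n ≡⟨ cong (_+ parts (suc j) c n) (shift-< (parts j (suc c)) (<-≤-trans n<b² (*-mono-≤ (s≤s (≤′⇒≤ b≤′c)) (s≤s (≤′⇒≤ b≤′c))))) ⟩
    parts (suc j) c n                           ≡⟨ go b≤′c ⟩
    parts (suc j) b n                           ∎
    where
    open ≡-Reasoning

-- A base with square above `n` never occurs. This carries counts computed with one fixed bound over
-- to the bound wanted for a particular `n`.
parts-bound-irrelevant : ∀ j {b c n} → n < suc b * suc b → n < suc c * suc c →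
  parts (suc j) b n ≡ parts (suc j) c n
parts-bound-irrelevant j {b} {c} n<b² n<c² with ≤-total b c
... | inj₁ b≤c = sym (parts-stable j b≤c n<b²)
... | inj₂ c≤b = parts-stable j c≤b n<c²

-- A partition is determined by its `j` bases in order, each with `b` choices. The crude bound keeps
-- digits below the base `X`.
parts-≤ : ∀ j b n → parts j b n ≤ b ^ j
parts-≤ zero    b n = ≤-trans (≤-reflexive (parts-zero b n)) (δ≤1 n)
  where
  δ≤1 : ∀ n → δ n ≤ 1
  δ≤1 zero    = ≤-refl
  δ≤1 (suc n) = z≤n
parts-≤ (suc j) zero    n = ≤-reflexive (parts-base j n)
parts-≤ (suc j) (suc b) n = begin
  parts (suc j) (suc b) n                     ≡⟨ parts-suc j b n ⟩
  withLargest j (suc b) n + parts (suc j) b n ≤⟨ +-mono-≤ (shift-≤ (suc b * suc b) (parts-≤ j (suc b)) n) (parts-≤ (suc j) b n) ⟩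
  suc b ^ j + b ^ suc j                       ≤⟨ +-monoʳ-≤ (suc b ^ j) (*-monoʳ-≤ b (^-monoˡ-≤ j (n≤1+n b))) ⟩
  suc b ^ suc j                               ∎
  where open ≤-Reasoning

-- Ordered representations

sumShift : ℕ → Seq → Seq
sumShift zero    f n = 0
sumShift (suc b) f n = shift (suc b * suc b) f n + sumShift b f n

sumShift-mono : ∀ b {f g} → (∀ n → f n ≤ g n) → ∀ n → sumShift b f n ≤ sumShift b g n
sumShift-mono zero    f≤g n = z≤n
sumShift-mono (suc b) f≤g n = +-mono-≤ (shift-mono (suc b * suc b) f≤g n) (sumShift-mono b f≤g n)

sumShift-≤ : ∀ b {f M} → (∀ n → f n ≤ M) → ∀ n → sumShift b f n ≤ b * M
sumShift-≤ zero    f≤M n = z≤n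
sumShift-≤ (suc b) f≤M n = +-mono-≤ (shift-≤ (suc b * suc b) f≤M n) (sumShift-≤ b f≤M n)

sumShift-add : ∀ b f g n → sumShift b (λ i → f i + g i) n ≡ sumShift b f n + sumShift b g n
sumShift-add zero    f g n = refl
sumShift-add (suc b) f g n = trans
  (cong₂ _+_ (shift-add (suc b * suc b) f g n) (sumShift-add b f g n))
  (interchange (shift (suc b * suc b) f n) (shift (suc b * suc b) g n) (sumShift b f n) (sumShift b g n))
  where
  interchange : ∀ p q r s → (p + q) + (r + s) ≡ (p + r) + (q + s)
  interchange = solve-∀

sumShift-scale : ∀ b c f n → sumShift b (λ i → c * f i) n ≡ c * sumShift b f n
sumShift-scale zero    c f n = sym (*-zeroʳ c)
sumShift-scale (suc b) c f n = trans
  (cong₂ _+_ (shift-scale (suc b * suc b) c f n) (sumShift-scale b c f n))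
  (sym (*-distribˡ-+ c _ _))

sumShift-shift : ∀ b s f n → sumShift b (shift s f) n ≡ shift s (sumShift b f) n
sumShift-shift zero    s f n = sym (shift-zero s n)
sumShift-shift (suc b) s f n = trans
  (cong₂ _+_ (shift-comm (suc b * suc b) s f n) (sumShift-shift b s f n))
  (sym (shift-add s (shift (suc b * suc b) f) (sumShift b f) n))

-- Ordered j-tuples of positive bases ≤ b; unlike parts, its generating function is a j-th power.
ordered : ℕ → ℕ → Seq
ordered zero    b = δ
ordered (suc j) b = sumShift b (ordered j b)

ordered-≤ : ∀ j b n → ordered j b n ≤ b ^ j
ordered-≤ zero    b zero    = ≤-refl
ordered-≤ zero    b (suc n) = z≤n
ordered-≤ (suc j) b n       = sumShift-≤ b (ordered-≤ j b) n

-- Union bound over the position of a part equal to suc b.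
ordered-suc-≤ : ∀ j b n →
  ordered (suc j) (suc b) n ≤ ordered (suc j) b n + suc j * shift (suc b * suc b) (ordered j (suc b)) n
ordered-suc-≤ zero b n =
  ≤-reflexive (trans (+-comm (shift (suc b * suc b) δ n) _) (cong (λ u → sumShift b δ n + u) (sym (+-identityʳ _))))
ordered-suc-≤ (suc j) b n = begin
  Y + sumShift b (ordered (suc j) (suc b)) n
    ≤⟨ +-monoʳ-≤ Y (sumShift-mono b (ordered-suc-≤ j b) n) ⟩
  Y + sumShift b (λ i → ordered (suc j) b i + suc j * shift s (ordered j (suc b)) i) n
    ≡⟨ cong (λ u → Y + u) (sumShift-add b (ordered (suc j) b) _ n) ⟩
  Y + (Z + sumShift b (λ i → suc j * shift s (ordered j (suc b)) i) n)
    ≡⟨ cong (λ u → Y + (Z + u)) (trans (sumShift-scale b (suc j) _ n)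
         (cong (suc j *_) (sumShift-shift b s (ordered j (suc b)) n))) ⟩
  Y + (Z + suc j * shift s (sumShift b (ordered j (suc b))) n)
    -- `sumShift b (ordered j (suc b))` is `ordered (suc j) (suc b)` without its term for the base
    -- `suc b`.
    ≤⟨ +-monoʳ-≤ Y (+-monoʳ-≤ Z (*-monoʳ-≤ (suc j) (shift-mono s (λ i → m≤n+m _ _) n))) ⟩
  Y + (Z + suc j * Y)
    ≡⟨ rearrange Y Z (suc j * Y) ⟩
  Z + suc (suc j) * Y ∎
  where
  open ≤-Reasoning
  s = suc b * suc b
  Y = shift s (ordered (suc j) (suc b)) n
  Z = ordered (suc (suc j)) b n
  rearrange : ∀ p q r → p + (q + r) ≡ q + (p + r)
  rearrange = solve-∀

-- Each multiset of `j` bases has at most `j !` orderings; so a lower bound on ordered tuples yields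
-- one on partitions.
ordered≤!*parts : ∀ j b n → ordered j b n ≤ j ! * parts j b n
ordered≤!*parts zero    b n = ≤-reflexive (sym (trans (+-identityʳ _) (parts-zero b n)))
ordered≤!*parts (suc j) zero n = z≤n
ordered≤!*parts (suc j) (suc b) n = begin
  ordered (suc j) (suc b) n
    ≤⟨ ordered-suc-≤ j b n ⟩
  ordered (suc j) b n + suc j * shift s (ordered j (suc b)) n
    ≤⟨ +-mono-≤ (ordered≤!*parts (suc j) b n)
                (*-monoʳ-≤ (suc j) (shift-mono s (ordered≤!*parts j (suc b)) n)) ⟩
  suc j ! * P + suc j * shift s (λ i → j ! * parts j (suc b) i) n
    ≡⟨ cong (λ u → suc j ! * P + suc j * u) (shift-scale s (j !) (parts j (suc b)) n) ⟩
  suc j ! * P + suc j * (j ! * Y)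
    ≡⟨ collect (suc j) (j !) P Y ⟩
  suc j ! * (Y + P)
    ≡⟨ cong (suc j ! *_) (parts-suc j b n) ⟨
  suc j ! * parts (suc j) (suc b) n ∎
  where
  open ≤-Reasoning
  s = suc b * suc b
  P = parts (suc j) b n
  Y = withLargest j (suc b) n
  collect : ∀ a c p y → a * c * p + a * (c * y) ≡ a * c * (y + p)
  collect = solve-∀

-- Kronecker substitution

module Packed (X : ℕ) {{_ : NonZero X}} where

  -- The lowest N coefficients of the packed polynomial P are f 0, …, f (N − 1);
  -- they need not be smaller than X, so this is stable under sums and products.
  Packs : ℕ → ℕ → Seq → Set
  Packs zero    P f = ⊤
  Packs (suc N) P f = ∃ λ Q → P ≡ f 0 + X * Q × Packs N Q (f ∘ suc)

  Packs-cong : ∀ N {P f g} → (∀ n → f n ≡ g n) → Packs N P f → Packs N P g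
  Packs-cong zero    f≡g _            = tt
  Packs-cong (suc N) f≡g (Q , eq , r) = Q , trans eq (cong (_+ X * Q) (f≡g 0)) , Packs-cong N (f≡g ∘ suc) r

  Packs-zero : ∀ N → Packs N 0 (λ _ → 0)
  Packs-zero zero    = tt
  Packs-zero (suc N) = 0 , sym (*-zeroʳ X) , Packs-zero N

  Packs-δ : ∀ N → Packs N 1 δ
  Packs-δ zero    = tt
  Packs-δ (suc N) = 0 , cong suc (sym (*-zeroʳ X)) , Packs-zero N

  Packs-add : ∀ N {P Q f g} → Packs N P f → Packs N Q g → Packs N (P + Q) (λ n → f n + g n)
  Packs-add zero    _ _ = tt
  Packs-add (suc N) {f = f} {g} (P , refl , p) (Q , refl , q) =
    P + Q , gather X (f 0) (g 0) P Q , Packs-add N p q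
    where
    gather : ∀ x a b u v → (a + x * u) + (b + x * v) ≡ a + b + x * (u + v)
    gather = solve-∀

  Packs-shift : ∀ N s {P f} → Packs N P f → Packs N (X ^ s * P) (shift s f)
  Packs-shift zero    s       _       = tt
  Packs-shift (suc N) zero    {P} {f} p = subst (λ Q → Packs (suc N) Q f) (sym (*-identityˡ P)) p
  -- The shifted sequence begins with 0, so one coefficient fewer of `f` is required.
  Packs-shift (suc N) (suc s) {P} {f} p =
    X ^ s * P , *-assoc X (X ^ s) P , Packs-shift N s (init N p)
    where
    init : ∀ N {P f} → Packs (suc N) P f → Packs N P f
    init zero    _            = tt
    init (suc N) (Q , eq , r) = Q , eq , init N r

  packedSquares : ℕ → ℕ
  packedSquares zero    = 0
  packedSquares (suc b) = X ^ (suc b * suc b) + packedSquares b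

  Packs-sumShift : ∀ N b {P f} → Packs N P f → Packs N (packedSquares b * P) (sumShift b f)
  Packs-sumShift N zero    p = Packs-zero N
  Packs-sumShift N (suc b) {P} {f} p =
    subst (λ Q → Packs N Q (sumShift (suc b) f)) (sym (*-distribʳ-+ P (X ^ (suc b * suc b)) (packedSquares b)))
      (Packs-add N (Packs-shift N (suc b * suc b) p) (Packs-sumShift N b p))

  Packs-ordered : ∀ N j b → Packs N (packedSquares b ^ j) (ordered j b)
  Packs-ordered N zero    b = Packs-δ N
  Packs-ordered N (suc j) b = Packs-sumShift N b (Packs-ordered N j b)

  packedParts : ℕ → ℕ → ℕ
  packedParts zero    b       = 1
  packedParts (suc j) zero    = 0
  packedParts (suc j) (suc b) = X ^ (suc b * suc b) * packedParts j (suc b) + packedParts (suc j) b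

  Packs-parts : ∀ N j b → Packs N (packedParts j b) (parts j b)
  Packs-parts N zero    b       = Packs-cong N (λ n → sym (parts-zero b n)) (Packs-δ N)
  Packs-parts N (suc j) zero    = Packs-cong N (λ n → sym (parts-base j n)) (Packs-zero N)
  Packs-parts N (suc j) (suc b) = Packs-cong N (λ n → sym (parts-suc j b n))
    (Packs-add N (Packs-shift N (suc b * suc b) (Packs-parts N j (suc b))) (Packs-parts N (suc j) b))

  nextPower : ∀ b → X ^ (suc b * suc b) * X ^ (3 + 2 * b) ≡ X ^ (suc (suc b) * suc (suc b))
  nextPower b = trans (sym (^-distribˡ-+-* X (suc b * suc b) (3 + 2 * b))) (cong (X ^_) (exponents b))
    where
    exponents : ∀ b → suc b * suc b + (3 + 2 * b) ≡ suc (suc b) * suc (suc b)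
    exponents = solve-∀

  nextRatio : ∀ b → X ^ (3 + 2 * b) * (X * X) ≡ X ^ (3 + 2 * suc b)
  nextRatio b = trans (rotate (X ^ (3 + 2 * b)) X) (cong (X ^_) (exponents b))
    where
    rotate : ∀ u x → u * (x * x) ≡ x * (x * u)
    rotate = solve-∀
    exponents : ∀ b → 2 + (3 + 2 * b) ≡ 3 + 2 * suc b
    exponents = solve-∀

  -- The accumulators A = X ^ (suc b)², C = X ^ (3 + 2 b) step through the powers
  -- X ^ k² by one multiplication each.
  squaresLoop : ℕ → ℕ → ℕ → ℕ → ℕ
  squaresLoop zero       A C S = S
  squaresLoop (suc fuel) A C S = squaresLoop fuel (A * C) (C * (X * X)) (A + S)

  squaresLoop-correct : ∀ fuel b {A C S} → A ≡ X ^ (suc b * suc b) → C ≡ X ^ (3 + 2 * b) →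
    S ≡ packedSquares b → squaresLoop fuel A C S ≡ packedSquares (fuel + b)
  squaresLoop-correct zero       b refl refl refl = refl
  squaresLoop-correct (suc fuel) b refl refl refl =
    trans (squaresLoop-correct fuel (suc b) (nextPower b) (nextRatio b) refl)
          (cong packedSquares (+-suc fuel b))

  fastSquares : ℕ → ℕ
  fastSquares b = squaresLoop b X (X * (X * X)) 0

  fastSquares-correct : ∀ b → fastSquares b ≡ packedSquares b
  fastSquares-correct b = trans
    (squaresLoop-correct b 0 (sym (*-identityʳ X)) (cong (λ u → X * (X * u)) (sym (*-identityʳ X))) refl)
    (cong packedSquares (+-identityʳ b))

  square : ℕ → ℕ
  square m = m * m

  fastOrdered₄ : ℕ → ℕ
  fastOrdered₄ b = square (square (fastSquares b))

  Packs-fastOrdered₄ : ∀ N b → Packs N (fastOrdered₄ b) (ordered 4 b)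
  Packs-fastOrdered₄ N b = subst (λ P → Packs N P (ordered 4 b))
    (trans (fourth (packedSquares b)) (cong (square ∘ square) (sym (fastSquares-correct b))))
    (Packs-ordered N 4 b)
    where
    fourth : ∀ t → t * (t * (t * (t * 1))) ≡ (t * t) * (t * t)
    fourth = solve-∀

  -- `P₁` to `P₅` are the values for one to five parts at the current bound. Each update uses the
  -- already updated value for one part fewer, because a base may repeat; the chain `next₁` to
  -- `next₅` names every new value so that it can be shared.
  partsLoop : ℕ → ℕ → ℕ → ℕ → ℕ → ℕ → ℕ → ℕ → ℕ
  partsLoop zero       A C P₁ P₂ P₃ P₄ P₅ = P₅
  -- The factor 1 is `packedParts 0`; with it a round unfolds exactly to the recursion of
  -- `packedParts`.
  partsLoop (suc fuel) A C P₁ P₂ P₃ P₄ P₅ = next₁ (A * 1 + P₁)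
    where
    next₅ : ℕ → ℕ → ℕ → ℕ → ℕ → ℕ
    next₅ Q₁ Q₂ Q₃ Q₄ Q₅ = partsLoop fuel (A * C) (C * (X * X)) Q₁ Q₂ Q₃ Q₄ Q₅
    next₄ : ℕ → ℕ → ℕ → ℕ → ℕ
    next₄ Q₁ Q₂ Q₃ Q₄ = next₅ Q₁ Q₂ Q₃ Q₄ (A * Q₄ + P₅)
    next₃ : ℕ → ℕ → ℕ → ℕ
    next₃ Q₁ Q₂ Q₃ = next₄ Q₁ Q₂ Q₃ (A * Q₃ + P₄)
    next₂ : ℕ → ℕ → ℕ
    next₂ Q₁ Q₂ = next₃ Q₁ Q₂ (A * Q₂ + P₃)
    next₁ : ℕ → ℕ
    next₁ Q₁ = next₂ Q₁ (A * Q₁ + P₂)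

  partsLoop-correct : ∀ fuel b {A C} → A ≡ X ^ (suc b * suc b) → C ≡ X ^ (3 + 2 * b) →
    partsLoop fuel A C (packedParts 1 b) (packedParts 2 b) (packedParts 3 b) (packedParts 4 b) (packedParts 5 b)
      ≡ packedParts 5 (fuel + b)
  partsLoop-correct zero       b refl refl = refl
  partsLoop-correct (suc fuel) b refl refl =
    trans (partsLoop-correct fuel (suc b) (nextPower b) (nextRatio b))
          (cong (packedParts 5) (+-suc fuel b))

  fastParts₅ : ℕ → ℕ
  fastParts₅ b = partsLoop b X (X * (X * X)) 0 0 0 0 0

  Packs-fastParts₅ : ∀ N b → Packs N (fastParts₅ b) (parts 5 b)
  Packs-fastParts₅ N b = subst (λ P → Packs N P (parts 5 b))
    (sym (trans (partsLoop-correct b 0 (sym (*-identityʳ X)) (cong (λ u → X * (X * u)) (sym (*-identityʳ X))))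
                (cong (packedParts 5) (+-identityʳ b))))
    (Packs-parts N 5 b)

  Packs-head : ∀ N {P f} → f 0 < X → Packs (suc N) P f → P % X ≡ f 0 × Packs N (P / X) (f ∘ suc)
  Packs-head N {f = f} f0<X (Q , refl , r) = remainder , subst (λ u → Packs N u (f ∘ suc)) (sym quotient) r
    where
    remainder : (f 0 + X * Q) % X ≡ f 0
    remainder = trans (cong (λ u → (f 0 + u) % X) (*-comm X Q))
                      (trans ([m+kn]%n≡m%n (f 0) Q X) (m<n⇒m%n≡m f0<X))
    quotient : (f 0 + X * Q) / X ≡ Q
    quotient = trans (cong (λ u → (f 0 + u) / X) (*-comm X Q))
              (trans (+-distrib-/-∣ʳ (f 0) (n∣m*n Q))
              (cong₂ _+_ (m<n⇒m/n≡0 f0<X) (m*n/n≡m Q X)))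

  -- Since all digits lie below `X`, no carry crosses position `a`: the low part `R` stays below
  -- `X ^ a` and is thus the remainder of the division by it.
  Packs-split : ∀ a b {P f} → (∀ n → f n < X) → Packs (a + b) P f →
    ∃₂ λ R Q → P ≡ R + X ^ a * Q × R < X ^ a × Packs a R f × Packs b Q (λ n → f (a + n))
  Packs-split zero    b {P} f<X p = 0 , P , sym (*-identityˡ P) , s≤s z≤n , tt , p
  Packs-split (suc a) b {f = f} f<X (P , refl , p) with Packs-split a b (f<X ∘ suc) p
  ... | R , Q , refl , R<Xᵃ , r , q =
    f 0 + X * R , Q , regroup (f 0) X R (X ^ a) Q , small , (R , refl , r) , q
    where
    regroup : ∀ c x r y q → c + x * (r + y * q) ≡ c + x * r + x * y * q
    regroup = solve-∀
    small : f 0 + X * R < X * X ^ a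
    small = begin-strict
      f 0 + X * R <⟨ +-monoˡ-< (X * R) (f<X 0) ⟩
      X + X * R   ≡⟨ *-suc X R ⟨
      X * suc R   ≤⟨ *-monoʳ-≤ X R<Xᵃ ⟩
      X * X ^ a   ∎
      where open ≤-Reasoning

  -- The divisor appears as `suc h`, the form in which `scan` meets it after matching, so that it is
  -- visibly nonzero.
  Packs-divMod : ∀ a b {P f} h → suc h ≡ X ^ a → (∀ n → f n < X) → Packs (a + b) P f →
    Packs a (P % suc h) f × Packs b (P / suc h) (λ n → f (a + n))
  Packs-divMod a b {f = f} h h≡Xᵃ f<X p with Packs-split a b f<X p
  ... | R , Q , refl , R<Xᵃ , r , q rewrite sym h≡Xᵃ =
    subst (λ u → Packs a u f) (sym remainder) r ,
    subst (λ u → Packs b u (λ n → f (a + n))) (sym quotient) q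
    where
    remainder : (R + suc h * Q) % suc h ≡ R
    remainder = trans (cong (λ u → (R + u) % suc h) (*-comm (suc h) Q))
                      (trans ([m+kn]%n≡m%n R Q (suc h)) (m<n⇒m%n≡m R<Xᵃ))
    quotient : (R + suc h * Q) / suc h ≡ Q
    quotient = trans (cong (λ u → (R + u) / suc h) (*-comm (suc h) Q))
              (trans (+-distrib-/-∣ʳ R (n∣m*n Q))
              (cong₂ _+_ (m<n⇒m/n≡0 R<Xᵃ) (m*n/n≡m Q (suc h))))

  -- Testing all digits of a packed number

  module Scan (test : ℕ → ℕ → Bool) (leaf : ℕ) where

    -- `i` is the position of the lowest digit of `P` in the number scanned, which lets `test`
    -- depend on the index as well.
    scanLeaf : ℕ → ℕ → ℕ → Bool
    scanLeaf zero    i P = true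
    scanLeaf (suc c) i P = test i (P % X) ∧ scanLeaf c (suc i) (P / X)

    size : List ℕ → ℕ
    size []       = leaf
    size (_ ∷ hs) = size hs + size hs

    -- Divide and conquer; hs lists the powers of X at which P is split.
    scan : List ℕ → ℕ → ℕ → Bool
    scan []           i P = scanLeaf leaf i P
    -- No power of `X` is zero; the value `false` makes this case vacuous in the soundness proof.
    scan (zero  ∷ hs) i P = false
    scan (suc h ∷ hs) i P = scan hs i (P % suc h) ∧ scan hs (size hs + i) (P / suc h)

    -- Doubling the block length squares the power of `X`, so every further splitter costs one
    -- multiplication.
    extend : List ℕ → List ℕ
    extend []       = X ^ leaf ∷ []
    extend (h ∷ hs) = h * h ∷ h ∷ hs

    splitters : ℕ → List ℕ
    splitters zero    = []
    splitters (suc d) = extend (splitters d)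

    ∧-true : ∀ {a b} → a ∧ b ≡ true → a ≡ true × b ≡ true
    ∧-true {true} {true} _ = refl , refl

    scanLeaf-sound : ∀ c i {P f} → (∀ n → f n < X) → Packs c P f → scanLeaf c i P ≡ true →
      ∀ {n} → n < c → test (n + i) (f n) ≡ true
    scanLeaf-sound (suc c) i {P} {f} f<X p ok {n} n<c
      with Packs-head c {f = f} (f<X 0) p | ∧-true {test i (P % X)} ok
    scanLeaf-sound (suc c) i {P} {f} f<X p ok {zero} n<c | P%X≡f0 , _ | okHead , _ =
      subst (λ u → test i u ≡ true) P%X≡f0 okHead
    scanLeaf-sound (suc c) i {P} {f} f<X p ok {suc n} (s≤s n<c) | _ , q | _ , okTail =
      subst (λ u → test u (f (suc n)) ≡ true) (+-suc n i)
        (scanLeaf-sound c (suc i) (f<X ∘ suc) q okTail n<c)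

    Splitters : List ℕ → Set
    Splitters []       = ⊤
    Splitters (h ∷ hs) = h ≡ X ^ size hs × Splitters hs

    scan-sound : ∀ hs i {P f} → Splitters hs → (∀ n → f n < X) → Packs (size hs) P f → scan hs i P ≡ true →
      ∀ {n} → n < size hs → test (n + i) (f n) ≡ true
    scan-sound []           i _          f<X p ok n< = scanLeaf-sound leaf i f<X p ok n<
    scan-sound (suc h ∷ hs) i {f = f} (h≡ , hs≡) f<X p ok {n} n<
      with Packs-divMod (size hs) (size hs) {f = f} h h≡ f<X p | ∧-true {scan hs i _} ok
    ... | r , q | okLow , okHigh with n <? size hs
    ...   | yes n<size = scan-sound hs i hs≡ f<X r okLow n<size
    ...   | no  n≮size = subst₂ (λ u v → test u (f v) ≡ true) index (m+[n∸m]≡n size≤n)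
        (scan-sound hs (size hs + i) hs≡ (λ m → f<X (size hs + m)) q okHigh n∸size<size)
      where
      size≤n : size hs ≤ n
      size≤n = ≮⇒≥ n≮size
      n∸size<size : n ∸ size hs < size hs
      n∸size<size = +-cancelˡ-< (size hs) (n ∸ size hs) (size hs) (subst (_< size hs + size hs) (sym (m+[n∸m]≡n size≤n)) n<)
      index : n ∸ size hs + (size hs + i) ≡ n + i
      index = trans (sym (+-assoc (n ∸ size hs) (size hs) i)) (cong (_+ i) (m∸n+n≡m size≤n))

    splitters-valid : ∀ d → Splitters (splitters d)
    splitters-valid zero    = tt
    splitters-valid (suc d) = extend-valid (splitters d) (splitters-valid d)
      where
      extend-valid : ∀ hs → Splitters hs → Splitters (extend hs)
      extend-valid []       _            = refl , tt
      extend-valid (h ∷ hs) (refl , hs≡) = sym (^-distribˡ-+-* X (size hs) (size hs)) , refl , hs≡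

    scanAll : ℕ → ℕ → Bool
    scanAll d P = scan (splitters d) 0 P

    size-splitters : ∀ d → size (splitters d) ≡ leaf * 2 ^ d
    size-splitters zero    = sym (*-identityʳ leaf)
    size-splitters (suc d) = trans (size-extend (splitters d))
      (trans (cong (λ u → u + u) (size-splitters d)) (double leaf (2 ^ d)))
      where
      size-extend : ∀ hs → size (extend hs) ≡ size hs + size hs
      size-extend []       = refl
      size-extend (_ ∷ hs) = refl
      double : ∀ l t → l * t + l * t ≡ l * (2 * t)
      double = solve-∀

    scanAll-sound : ∀ d {P f} → (∀ n → f n < X) → (∀ N → Packs N P f) → scanAll d P ≡ true →
      ∀ {n} → n < leaf * 2 ^ d → test n (f n) ≡ true
    scanAll-sound d {f = f} f<X p ok {n} n< = subst (λ u → test u (f n) ≡ true) (+-identityʳ n)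
      (scan-sound (splitters d) 0 (splitters-valid d) f<X (p _) ok (subst (n <_) (sym (size-splitters d)) n<))

    -- Digits below `X` cannot carry, so a successful evaluation of `scanAll` has inspected the
    -- coefficients themselves.
    scan-ordered₄ : ∀ d b → b ^ 4 < X → scanAll d (fastOrdered₄ b) ≡ true →
      ∀ {n} → n < leaf * 2 ^ d → test n (ordered 4 b n) ≡ true
    scan-ordered₄ d b b⁴<X = scanAll-sound d (λ n → ≤-<-trans (ordered-≤ 4 b n) b⁴<X) (λ N → Packs-fastOrdered₄ N b)

    scan-parts₅ : ∀ d b → b ^ 5 < X → scanAll d (fastParts₅ b) ≡ true →
      ∀ {n} → n < leaf * 2 ^ d → test n (parts 5 b n) ≡ true
    scan-parts₅ d b b⁵<X = scanAll-sound d (λ n → ≤-<-trans (parts-≤ 5 b n) b⁵<X) (λ N → Packs-fastParts₅ N b)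

-- Lagrange's four-square theorem

-- Euler's identity for x = m p + a and so on: in the cross terms the parts free of `m` cancel, and
-- the scalar product is a multiple of `m` plus the norm of the residues. Once that norm is a
-- multiple of `m`, the whole is visibly a multiple of m².
descentIdentity : ∀ m p q s t a b c d →
    ((m ℤ.* p ℤ.+ a) ℤ.* (m ℤ.* p ℤ.+ a) ℤ.+ (m ℤ.* q ℤ.+ b) ℤ.* (m ℤ.* q ℤ.+ b)
      ℤ.+ (m ℤ.* s ℤ.+ c) ℤ.* (m ℤ.* s ℤ.+ c) ℤ.+ (m ℤ.* t ℤ.+ d) ℤ.* (m ℤ.* t ℤ.+ d))
      ℤ.* (a ℤ.* a ℤ.+ b ℤ.* b ℤ.+ c ℤ.* c ℤ.+ d ℤ.* d)
    ≡ (m ℤ.* (p ℤ.* a ℤ.+ q ℤ.* b ℤ.+ s ℤ.* c ℤ.+ t ℤ.* d) ℤ.+ (a ℤ.* a ℤ.+ b ℤ.* b ℤ.+ c ℤ.* c ℤ.+ d ℤ.* d))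
      ℤ.* (m ℤ.* (p ℤ.* a ℤ.+ q ℤ.* b ℤ.+ s ℤ.* c ℤ.+ t ℤ.* d) ℤ.+ (a ℤ.* a ℤ.+ b ℤ.* b ℤ.+ c ℤ.* c ℤ.+ d ℤ.* d))
    ℤ.+ m ℤ.* m ℤ.* 
       ((p ℤ.* b ℤ.- q ℤ.* a ℤ.+ (s ℤ.* d ℤ.- t ℤ.* c)) ℤ.* (p ℤ.* b ℤ.- q ℤ.* a ℤ.+ (s ℤ.* d ℤ.- t ℤ.* c))
       ℤ.+ (p ℤ.* c ℤ.- s ℤ.* a ℤ.+ (t ℤ.* b ℤ.- q ℤ.* d)) ℤ.* (p ℤ.* c ℤ.- s ℤ.* a ℤ.+ (t ℤ.* b ℤ.- q ℤ.* d))
       ℤ.+ (p ℤ.* d ℤ.- t ℤ.* a ℤ.+ (q ℤ.* c ℤ.- s ℤ.* b)) ℤ.* (p ℤ.* d ℤ.- t ℤ.* a ℤ.+ (q ℤ.* c ℤ.- s ℤ.* b)))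
descentIdentity = ℤSolver.solve-∀

-- Norm of the quaternion product of x + y i + z j + w k with the conjugate of a + b i + c j + d k;
-- the imaginary parts appear up to sign.
eulerIdentity : ∀ x y z w a b c d →
  (x ℤ.* x ℤ.+ y ℤ.* y ℤ.+ z ℤ.* z ℤ.+ w ℤ.* w) ℤ.* (a ℤ.* a ℤ.+ b ℤ.* b ℤ.+ c ℤ.* c ℤ.+ d ℤ.* d) ≡
  (x ℤ.* a ℤ.+ y ℤ.* b ℤ.+ z ℤ.* c ℤ.+ w ℤ.* d) ℤ.* (x ℤ.* a ℤ.+ y ℤ.* b ℤ.+ z ℤ.* c ℤ.+ w ℤ.* d)
    ℤ.+ (x ℤ.* b ℤ.- y ℤ.* a ℤ.+ (z ℤ.* d ℤ.- w ℤ.* c)) ℤ.* (x ℤ.* b ℤ.- y ℤ.* a ℤ.+ (z ℤ.* d ℤ.- w ℤ.* c))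
    ℤ.+ (x ℤ.* c ℤ.- z ℤ.* a ℤ.+ (w ℤ.* b ℤ.- y ℤ.* d)) ℤ.* (x ℤ.* c ℤ.- z ℤ.* a ℤ.+ (w ℤ.* b ℤ.- y ℤ.* d))
    ℤ.+ (x ℤ.* d ℤ.- w ℤ.* a ℤ.+ (y ℤ.* c ℤ.- z ℤ.* b)) ℤ.* (x ℤ.* d ℤ.- w ℤ.* a ℤ.+ (y ℤ.* c ℤ.- z ℤ.* b))
eulerIdentity = ℤSolver.solve-∀

FourSquares : ℕ → Set
FourSquares n = ∃₂ λ a b → ∃₂ λ c d → n ≡ a * a + b * b + c * c + d * d

ℤFourSquares : ℤ → Set
ℤFourSquares i = ∃₂ λ x y → ∃₂ λ z w → i ≡ x ℤ.* x ℤ.+ y ℤ.* y ℤ.+ z ℤ.* z ℤ.+ w ℤ.* w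

abs-square : ∀ i → i ℤ.* i ≡ + (∣ i ∣ * ∣ i ∣)
abs-square (+ n)    = sym (ℤ.pos-* n n)
abs-square -[1+ n ] = refl

abs-sumOfSquares : ∀ x y z w → x ℤ.* x ℤ.+ y ℤ.* y ℤ.+ z ℤ.* z ℤ.+ w ℤ.* w ≡
  + (∣ x ∣ * ∣ x ∣ + ∣ y ∣ * ∣ y ∣ + ∣ z ∣ * ∣ z ∣ + ∣ w ∣ * ∣ w ∣)
abs-sumOfSquares x y z w =
  cong₂ ℤ._+_ (cong₂ ℤ._+_ (cong₂ ℤ._+_ (abs-square x) (abs-square y)) (abs-square z)) (abs-square w)

fromℤ : ∀ {n} → ℤFourSquares (+ n) → FourSquares n
fromℤ (x , y , z , w , n≡) = ∣ x ∣ , ∣ y ∣ , ∣ z ∣ , ∣ w ∣ , ℤ.+-injective (trans n≡ (abs-sumOfSquares x y z w))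

toℤ : ∀ {n} → FourSquares n → ℤFourSquares (+ n)
toℤ (a , b , c , d , n≡) = + a , + b , + c , + d , trans (cong +_ n≡) (sym (abs-sumOfSquares (+ a) (+ b) (+ c) (+ d)))

FourSquares-* : ∀ {m n} → FourSquares m → FourSquares n → FourSquares (m * n)
FourSquares-* {m} {n} M N with toℤ M | toℤ N
... | x , y , z , w , m≡ | a , b , c , d , n≡ =
  fromℤ ( x ℤ.* a ℤ.+ y ℤ.* b ℤ.+ z ℤ.* c ℤ.+ w ℤ.* d
        , x ℤ.* b ℤ.- y ℤ.* a ℤ.+ (z ℤ.* d ℤ.- w ℤ.* c)
        , x ℤ.* c ℤ.- z ℤ.* a ℤ.+ (w ℤ.* b ℤ.- y ℤ.* d)
        , x ℤ.* d ℤ.- w ℤ.* a ℤ.+ (y ℤ.* c ℤ.- z ℤ.* b)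
        , trans (ℤ.pos-* m n) (trans (cong₂ ℤ._*_ m≡ n≡) (eulerIdentity x y z w a b c d)))

-- The residue lies above -m/2 and is at most m/2. The tie is recorded as an equation with its sign,
-- since the descent must exclude four residues all equal to m/2.
centredResidue : ∀ m .{{_ : NonZero m}} x →
  ∃₂ λ q y → + x ≡ + m ℤ.* q ℤ.+ y × (2 * ∣ y ∣ < m ⊎ + 2 ℤ.* y ≡ + m)
centredResidue m x = pick (<-cmp (2 * r) m)
  where
  open ≡-Reasoning
  r = x % m
  q = x / m
  x≡ : + x ≡ + m ℤ.* + q ℤ.+ + r
  x≡ = begin
    + x                    ≡⟨ cong +_ (m≡m%n+[m/n]*n x m) ⟩
    + (r + q * m)          ≡⟨ cong +_ (trans (+-comm r (q * m)) (cong (_+ r) (*-comm q m))) ⟩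
    + (m * q) ℤ.+ + r      ≡⟨ cong (ℤ._+ + r) (ℤ.pos-* m q) ⟩
    + m ℤ.* + q ℤ.+ + r    ∎
  c = m ∸ r
  r+c≡m : r + c ≡ m
  r+c≡m = m+[n∸m]≡n (<⇒≤ (m%n<n x m))
  carry : ∀ r c q → (r ℤ.+ c) ℤ.* q ℤ.+ r ≡ (r ℤ.+ c) ℤ.* (q ℤ.+ + 1) ℤ.+ ℤ.- c
  carry = ℤSolver.solve-∀
  pick : _ → _
  pick (tri< 2r<m _ _) = + q , + r , x≡ , inj₁ 2r<m
  pick (tri≈ _ 2r≡m _) = + q , + r , x≡ , inj₂ (trans (sym (ℤ.pos-* 2 r)) (cong +_ 2r≡m))
  pick (tri> _ _ m<2r) = + q ℤ.+ + 1 , ℤ.- (+ c) ,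
    trans x≡ (subst (λ u → + u ℤ.* + q ℤ.+ + r ≡ + u ℤ.* (+ q ℤ.+ + 1) ℤ.+ ℤ.- (+ c)) r+c≡m (carry (+ r) (+ c) (+ q))) ,
    inj₁ (subst (λ u → 2 * u < m) (sym (ℤ.∣-i∣≡∣i∣ (+ c))) 2c<m)
    where
    2c<m : 2 * c < m
    2c<m = +-cancelˡ-< (2 * r) (2 * c) m (≤-<-trans
      (≤-reflexive (trans (sym (*-distribˡ-+ 2 r c)) (trans (cong (2 *_) r+c≡m) (cong (λ u → m + u) (+-identityʳ m)))))
      (+-monoˡ-< m m<2r))

-- The centred residues of the four bases have squares summing to `m * r` with `r < m`; multiplying
-- the two sums by Euler's identity and dividing by m² writes `r * p` as four squares.
descend : ∀ {p} → Prime p → ∀ m → 1 < m → m < p → FourSquares (m * p) →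
  ∃ λ r → 0 < r × r < m × FourSquares (r * p)
descend {p} p-prime m@(suc _) 1<m m<p (x₁ , x₂ , x₃ , x₄ , mp≡)
  with centredResidue m x₁ | centredResidue m x₂ | centredResidue m x₃ | centredResidue m x₄
... | q₁ , y₁ , x₁≡ , small₁ | q₂ , y₂ , x₂≡ , small₂ | q₃ , y₃ , x₃≡ , small₃ | q₄ , y₄ , x₄≡ , small₄ =
  finish r refl
  where
  M P L Q r : ℤ
  M = + m
  P = + p
  L = q₁ ℤ.* y₁ ℤ.+ q₂ ℤ.* y₂ ℤ.+ q₃ ℤ.* y₃ ℤ.+ q₄ ℤ.* y₄
  Q = q₁ ℤ.* q₁ ℤ.+ q₂ ℤ.* q₂ ℤ.+ q₃ ℤ.* q₃ ℤ.+ q₄ ℤ.* q₄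
  -- Expanding mp = Σ (m qᵢ + yᵢ)² gives Σ yᵢ² = m r with this `r`; its sign is settled in `finish`.
  r = P ℤ.- + 2 ℤ.* L ℤ.- M ℤ.* Q

  normSum : ℤ → ℤ → ℤ → ℤ → ℤ
  normSum a b c d = a ℤ.* a ℤ.+ b ℤ.* b ℤ.+ c ℤ.* c ℤ.+ d ℤ.* d

  X₁ X₂ X₃ X₄ : ℤ
  X₁ = M ℤ.* q₁ ℤ.+ y₁
  X₂ = M ℤ.* q₂ ℤ.+ y₂
  X₃ = M ℤ.* q₃ ℤ.+ y₃
  X₄ = M ℤ.* q₄ ℤ.+ y₄

  MP≡ : M ℤ.* P ≡ normSum X₁ X₂ X₃ X₄
  MP≡ = begin
    M ℤ.* P                                 ≡⟨ ℤ.pos-* m p ⟨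
    + (m * p)                               ≡⟨ cong +_ mp≡ ⟩
    + (x₁ * x₁ + x₂ * x₂ + x₃ * x₃ + x₄ * x₄) ≡⟨ abs-sumOfSquares (+ x₁) (+ x₂) (+ x₃) (+ x₄) ⟨
    normSum (+ x₁) (+ x₂) (+ x₃) (+ x₄)     ≡⟨ cong₂ (λ u v → normSum u v (+ x₃) (+ x₄)) x₁≡ x₂≡ ⟩
    normSum X₁ X₂ (+ x₃) (+ x₄)             ≡⟨ cong₂ (normSum X₁ X₂) x₃≡ x₄≡ ⟩
    normSum X₁ X₂ X₃ X₄                     ∎
    where open ≡-Reasoning

  expand : ∀ m p a b c d x y z w → x ℤ.* x ℤ.+ y ℤ.* y ℤ.+ z ℤ.* z ℤ.+ w ℤ.* w ≡
    ((m ℤ.* a ℤ.+ x) ℤ.* (m ℤ.* a ℤ.+ x) ℤ.+ (m ℤ.* b ℤ.+ y) ℤ.* (m ℤ.* b ℤ.+ y)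
      ℤ.+ (m ℤ.* c ℤ.+ z) ℤ.* (m ℤ.* c ℤ.+ z) ℤ.+ (m ℤ.* d ℤ.+ w) ℤ.* (m ℤ.* d ℤ.+ w)) ℤ.- m ℤ.* p
    ℤ.+ m ℤ.* (p ℤ.- + 2 ℤ.* (a ℤ.* x ℤ.+ b ℤ.* y ℤ.+ c ℤ.* z ℤ.+ d ℤ.* w)
      ℤ.- m ℤ.* (a ℤ.* a ℤ.+ b ℤ.* b ℤ.+ c ℤ.* c ℤ.+ d ℤ.* d))
  expand = ℤSolver.solve-∀

  S≡ : normSum y₁ y₂ y₃ y₄ ≡ M ℤ.* r
  S≡ = begin
    normSum y₁ y₂ y₃ y₄             ≡⟨ expand M P q₁ q₂ q₃ q₄ y₁ y₂ y₃ y₄ ⟩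
    normSum X₁ X₂ X₃ X₄ ℤ.- M ℤ.* P ℤ.+ M ℤ.* r ≡⟨ cong (λ u → u ℤ.- M ℤ.* P ℤ.+ M ℤ.* r) MP≡ ⟨
    M ℤ.* P ℤ.- M ℤ.* P ℤ.+ M ℤ.* r ≡⟨ cong (ℤ._+ M ℤ.* r) (ℤ.+-inverseʳ (M ℤ.* P)) ⟩
    ℤ.0ℤ ℤ.+ M ℤ.* r                ≡⟨ ℤ.+-identityˡ (M ℤ.* r) ⟩
    M ℤ.* r                         ∎
    where open ≡-Reasoning

  sizes : ℕ
  sizes = ∣ y₁ ∣ * ∣ y₁ ∣ + ∣ y₂ ∣ * ∣ y₂ ∣ + ∣ y₃ ∣ * ∣ y₃ ∣ + ∣ y₄ ∣ * ∣ y₄ ∣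

  sizes≡ : + sizes ≡ M ℤ.* r
  sizes≡ = trans (sym (abs-sumOfSquares y₁ y₂ y₃ y₄)) S≡

  B C D : ℤ
  B = q₁ ℤ.* y₂ ℤ.- q₂ ℤ.* y₁ ℤ.+ (q₃ ℤ.* y₄ ℤ.- q₄ ℤ.* y₃)
  C = q₁ ℤ.* y₃ ℤ.- q₃ ℤ.* y₁ ℤ.+ (q₄ ℤ.* y₂ ℤ.- q₂ ℤ.* y₄)
  D = q₁ ℤ.* y₄ ℤ.- q₄ ℤ.* y₁ ℤ.+ (q₂ ℤ.* y₃ ℤ.- q₃ ℤ.* y₂)

  rP-fourSquares : ℤFourSquares (r ℤ.* P)
  rP-fourSquares = L ℤ.+ r , B , C , D , ℤ.*-cancelˡ-≡ (M ℤ.* M) _ _ {{ℤ.i*j≢0 M M}} (begin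
    M ℤ.* M ℤ.* (r ℤ.* P)       ≡⟨ regroup M P r ⟩
    (M ℤ.* P) ℤ.* (M ℤ.* r)     ≡⟨ cong₂ ℤ._*_ MP≡ (sym S≡) ⟩
    normSum X₁ X₂ X₃ X₄ ℤ.* normSum y₁ y₂ y₃ y₄ ≡⟨ descentIdentity M q₁ q₂ q₃ q₄ y₁ y₂ y₃ y₄ ⟩
    outer (normSum y₁ y₂ y₃ y₄) ≡⟨ cong outer S≡ ⟩
    outer (M ℤ.* r)             ≡⟨ factor M L r (B ℤ.* B) (C ℤ.* C) (D ℤ.* D) ⟩
    M ℤ.* M ℤ.* normSum (L ℤ.+ r) B C D ∎)
    where
    open ≡-Reasoning
    outer : ℤ → ℤ
    outer u = (M ℤ.* L ℤ.+ u) ℤ.* (M ℤ.* L ℤ.+ u) ℤ.+ M ℤ.* M ℤ.* (B ℤ.* B ℤ.+ C ℤ.* C ℤ.+ D ℤ.* D)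
    regroup : ∀ m p r → m ℤ.* m ℤ.* (r ℤ.* p) ≡ (m ℤ.* p) ℤ.* (m ℤ.* r)
    regroup = ℤSolver.solve-∀
    factor : ∀ m l r b c d → (m ℤ.* l ℤ.+ m ℤ.* r) ℤ.* (m ℤ.* l ℤ.+ m ℤ.* r) ℤ.+ m ℤ.* m ℤ.* (b ℤ.+ c ℤ.+ d)
      ≡ m ℤ.* m ℤ.* ((l ℤ.+ r) ℤ.* (l ℤ.+ r) ℤ.+ b ℤ.+ c ℤ.+ d)
    factor = ℤSolver.solve-∀

  m∤p : ∀ z → P ≢ M ℤ.* z
  m∤p z P≡Mz with prime⇒irreducible p-prime (divides ∣ z ∣ (trans (cong ∣_∣ P≡Mz) (trans (ℤ.abs-* M z) (*-comm m ∣ z ∣))))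
  ... | inj₁ m≡1 = <⇒≢ 1<m (sym m≡1)
  ... | inj₂ m≡p = <⇒≢ m<p m≡p

  sizes≢0 : sizes ≢ 0
  -- All residues zero would make mp equal to m² Q, and `m` would divide the prime.
  sizes≢0 sizes≡0 = m∤p Q (ℤ.*-cancelˡ-≡ M P (M ℤ.* Q) (begin
    M ℤ.* P                                                     ≡⟨ MP≡ ⟩
    normSum X₁ X₂ X₃ X₄ ≡⟨ cong₂ (λ u v → normSum (M ℤ.* q₁ ℤ.+ u) (M ℤ.* q₂ ℤ.+ v) X₃ X₄) y₁≡0 y₂≡0 ⟩
    normSum (M ℤ.* q₁ ℤ.+ ℤ.0ℤ) (M ℤ.* q₂ ℤ.+ ℤ.0ℤ) X₃ X₄ ≡⟨ cong₂ (λ u v → normSum (M ℤ.* q₁ ℤ.+ ℤ.0ℤ) (M ℤ.* q₂ ℤ.+ ℤ.0ℤ) (M ℤ.* q₃ ℤ.+ u) (M ℤ.* q₄ ℤ.+ v)) y₃≡0 y₄≡0 ⟩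
    normSum (M ℤ.* q₁ ℤ.+ ℤ.0ℤ) (M ℤ.* q₂ ℤ.+ ℤ.0ℤ) (M ℤ.* q₃ ℤ.+ ℤ.0ℤ) (M ℤ.* q₄ ℤ.+ ℤ.0ℤ) ≡⟨ factor M q₁ q₂ q₃ q₄ ⟩
    M ℤ.* (M ℤ.* Q) ∎))
    where
    open ≡-Reasoning
    factor : ∀ m a b c d →
      (m ℤ.* a ℤ.+ ℤ.0ℤ) ℤ.* (m ℤ.* a ℤ.+ ℤ.0ℤ) ℤ.+ (m ℤ.* b ℤ.+ ℤ.0ℤ) ℤ.* (m ℤ.* b ℤ.+ ℤ.0ℤ)
      ℤ.+ (m ℤ.* c ℤ.+ ℤ.0ℤ) ℤ.* (m ℤ.* c ℤ.+ ℤ.0ℤ) ℤ.+ (m ℤ.* d ℤ.+ ℤ.0ℤ) ℤ.* (m ℤ.* d ℤ.+ ℤ.0ℤ)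
      ≡ m ℤ.* (m ℤ.* (a ℤ.* a ℤ.+ b ℤ.* b ℤ.+ c ℤ.* c ℤ.+ d ℤ.* d))
    factor = ℤSolver.solve-∀
    root : ∀ y → ∣ y ∣ * ∣ y ∣ ≡ 0 → y ≡ ℤ.0ℤ
    root y y²≡0 with m*n≡0⇒m≡0∨n≡0 ∣ y ∣ y²≡0
    ... | inj₁ y≡0 = ℤ.∣i∣≡0⇒i≡0 y≡0
    ... | inj₂ y≡0 = ℤ.∣i∣≡0⇒i≡0 y≡0
    s₃ = m+n≡0⇒m≡0 (∣ y₁ ∣ * ∣ y₁ ∣ + ∣ y₂ ∣ * ∣ y₂ ∣ + ∣ y₃ ∣ * ∣ y₃ ∣) sizes≡0
    s₂ = m+n≡0⇒m≡0 (∣ y₁ ∣ * ∣ y₁ ∣ + ∣ y₂ ∣ * ∣ y₂ ∣) s₃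
    y₁≡0 = root y₁ (m+n≡0⇒m≡0 (∣ y₁ ∣ * ∣ y₁ ∣) s₂)
    y₂≡0 = root y₂ (m+n≡0⇒n≡0 (∣ y₁ ∣ * ∣ y₁ ∣) s₂)
    y₃≡0 = root y₃ (m+n≡0⇒n≡0 (∣ y₁ ∣ * ∣ y₁ ∣ + ∣ y₂ ∣ * ∣ y₂ ∣) s₃)
    y₄≡0 = root y₄ (m+n≡0⇒n≡0 (∣ y₁ ∣ * ∣ y₁ ∣ + ∣ y₂ ∣ * ∣ y₂ ∣ + ∣ y₃ ∣ * ∣ y₃ ∣) sizes≡0)

  -- Otherwise 4 mp would be the sum of the (2 m qᵢ + m)², which is 4 m² (Q + Σ qᵢ + 1), so `m`
  -- would divide the prime.
  notAllHalf : + 2 ℤ.* y₁ ≡ M → + 2 ℤ.* y₂ ≡ M → + 2 ℤ.* y₃ ≡ M → ¬ (+ 2 ℤ.* y₄ ≡ M)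
  notAllHalf h₁ h₂ h₃ h₄ = m∤p (Q ℤ.+ (q₁ ℤ.+ q₂ ℤ.+ q₃ ℤ.+ q₄) ℤ.+ + 1) (ℤ.*-cancelˡ-≡ (+ 4 ℤ.* M) P _ {{ℤ.i*j≢0 (+ 4) M}} (begin
    + 4 ℤ.* M ℤ.* P   ≡⟨ ℤ.*-assoc (+ 4) M P ⟩
    + 4 ℤ.* (M ℤ.* P) ≡⟨ cong (+ 4 ℤ.*_) MP≡ ⟩
    + 4 ℤ.* normSum X₁ X₂ X₃ X₄ ≡⟨ double M q₁ q₂ q₃ q₄ y₁ y₂ y₃ y₄ ⟩
    halves (+ 2 ℤ.* y₁) (+ 2 ℤ.* y₂) (+ 2 ℤ.* y₃) (+ 2 ℤ.* y₄) ≡⟨ cong₂ (λ u v → halves u v (+ 2 ℤ.* y₃) (+ 2 ℤ.* y₄)) h₁ h₂ ⟩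
    halves M M (+ 2 ℤ.* y₃) (+ 2 ℤ.* y₄) ≡⟨ cong₂ (halves M M) h₃ h₄ ⟩
    halves M M M M ≡⟨ factor M q₁ q₂ q₃ q₄ ⟩
    + 4 ℤ.* M ℤ.* (M ℤ.* (Q ℤ.+ (q₁ ℤ.+ q₂ ℤ.+ q₃ ℤ.+ q₄) ℤ.+ + 1)) ∎))
    where
    open ≡-Reasoning
    halves : ℤ → ℤ → ℤ → ℤ → ℤ
    halves a b c d = normSum (+ 2 ℤ.* (M ℤ.* q₁) ℤ.+ a) (+ 2 ℤ.* (M ℤ.* q₂) ℤ.+ b) (+ 2 ℤ.* (M ℤ.* q₃) ℤ.+ c) (+ 2 ℤ.* (M ℤ.* q₄) ℤ.+ d)
    double : ∀ m a b c d x y z w →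
      + 4 ℤ.* ((m ℤ.* a ℤ.+ x) ℤ.* (m ℤ.* a ℤ.+ x) ℤ.+ (m ℤ.* b ℤ.+ y) ℤ.* (m ℤ.* b ℤ.+ y)
      ℤ.+ (m ℤ.* c ℤ.+ z) ℤ.* (m ℤ.* c ℤ.+ z) ℤ.+ (m ℤ.* d ℤ.+ w) ℤ.* (m ℤ.* d ℤ.+ w)) ≡
      (+ 2 ℤ.* (m ℤ.* a) ℤ.+ + 2 ℤ.* x) ℤ.* (+ 2 ℤ.* (m ℤ.* a) ℤ.+ + 2 ℤ.* x)
      ℤ.+ (+ 2 ℤ.* (m ℤ.* b) ℤ.+ + 2 ℤ.* y) ℤ.* (+ 2 ℤ.* (m ℤ.* b) ℤ.+ + 2 ℤ.* y)
      ℤ.+ (+ 2 ℤ.* (m ℤ.* c) ℤ.+ + 2 ℤ.* z) ℤ.* (+ 2 ℤ.* (m ℤ.* c) ℤ.+ + 2 ℤ.* z)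
      ℤ.+ (+ 2 ℤ.* (m ℤ.* d) ℤ.+ + 2 ℤ.* w) ℤ.* (+ 2 ℤ.* (m ℤ.* d) ℤ.+ + 2 ℤ.* w)
    double = ℤSolver.solve-∀
    factor : ∀ m a b c d →
      (+ 2 ℤ.* (m ℤ.* a) ℤ.+ m) ℤ.* (+ 2 ℤ.* (m ℤ.* a) ℤ.+ m)
      ℤ.+ (+ 2 ℤ.* (m ℤ.* b) ℤ.+ m) ℤ.* (+ 2 ℤ.* (m ℤ.* b) ℤ.+ m)
      ℤ.+ (+ 2 ℤ.* (m ℤ.* c) ℤ.+ m) ℤ.* (+ 2 ℤ.* (m ℤ.* c) ℤ.+ m)
      ℤ.+ (+ 2 ℤ.* (m ℤ.* d) ℤ.+ m) ℤ.* (+ 2 ℤ.* (m ℤ.* d) ℤ.+ m) ≡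
      + 4 ℤ.* m ℤ.* (m ℤ.* (a ℤ.* a ℤ.+ b ℤ.* b ℤ.+ c ℤ.* c ℤ.+ d ℤ.* d ℤ.+ (a ℤ.+ b ℤ.+ c ℤ.+ d) ℤ.+ + 1))
    factor = ℤSolver.solve-∀

  dbl² : ℤ → ℕ
  dbl² y = (2 * ∣ y ∣) * (2 * ∣ y ∣)

  weak : ∀ {y} → 2 * ∣ y ∣ < m ⊎ + 2 ℤ.* y ≡ M → dbl² y ≤ m * m
  weak     (inj₁ 2y<m) = *-mono-≤ (<⇒≤ 2y<m) (<⇒≤ 2y<m)
  weak {y} (inj₂ 2y≡M) = ≤-reflexive (cong₂ _*_ 2y≡m 2y≡m)
    where
    2y≡m : 2 * ∣ y ∣ ≡ m
    2y≡m = trans (sym (ℤ.abs-* (+ 2) y)) (cong ∣_∣ 2y≡M)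

  strict : ∀ y → 2 * ∣ y ∣ < m → dbl² y < m * m
  strict y 2y<m = *-mono-< 2y<m 2y<m

  sizes-bound : dbl² y₁ + dbl² y₂ + dbl² y₃ + dbl² y₄ < m * m + m * m + m * m + m * m
  sizes-bound = go small₁ small₂ small₃ small₄
    where
    go : _ → _ → _ → _ → _
    go (inj₁ l) _ _ _ = +-mono-<-≤ (+-mono-<-≤ (+-mono-<-≤ (strict y₁ l) (weak small₂)) (weak small₃)) (weak small₄)
    go _ (inj₁ l) _ _ = +-mono-<-≤ (+-mono-<-≤ (+-mono-≤-< (weak small₁) (strict y₂ l)) (weak small₃)) (weak small₄)
    go _ _ (inj₁ l) _ = +-mono-<-≤ (+-mono-≤-< (+-mono-≤ (weak small₁) (weak small₂)) (strict y₃ l)) (weak small₄)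
    go _ _ _ (inj₁ l) = +-mono-≤-< (+-mono-≤ (+-mono-≤ (weak small₁) (weak small₂)) (weak small₃)) (strict y₄ l)
    go (inj₂ h₁) (inj₂ h₂) (inj₂ h₃) (inj₂ h₄) = contradiction h₄ (notAllHalf h₁ h₂ h₃)

  sizes<m² : sizes < m * m
  sizes<m² = *-cancelˡ-< 4 sizes (m * m) (begin-strict
    4 * sizes ≡⟨ quadruple (∣ y₁ ∣) (∣ y₂ ∣) (∣ y₃ ∣) (∣ y₄ ∣) ⟨
    dbl² y₁ + dbl² y₂ + dbl² y₃ + dbl² y₄ <⟨ sizes-bound ⟩
    m * m + m * m + m * m + m * m ≡⟨ four (m * m) ⟩
    4 * (m * m) ∎)
    where
    open ≤-Reasoning
    quadruple : ∀ a b c d → (2 * a) * (2 * a) + (2 * b) * (2 * b) + (2 * c) * (2 * c) + (2 * d) * (2 * d)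
      ≡ 4 * (a * a + b * b + c * c + d * d)
    quadruple = solve-∀
    four : ∀ a → a + a + a + a ≡ 4 * a
    four = solve-∀

  finish : ∀ i → i ≡ r → ∃ λ r → 0 < r × r < m × FourSquares (r * p)
  finish -[1+ k ] i≡r = contradiction (trans sizes≡ (cong (M ℤ.*_) (sym i≡r))) (λ ())
  finish (+ k) i≡r = k , n≢0⇒n>0 k≢0 , k<m , fromℤ (subst ℤFourSquares kp≡ rP-fourSquares)
    where
    sizes≡mk : sizes ≡ m * k
    sizes≡mk = ℤ.+-injective (trans sizes≡ (trans (cong (M ℤ.*_) (sym i≡r)) (sym (ℤ.pos-* m k))))
    k≢0 : k ≢ 0
    k≢0 refl = sizes≢0 (trans sizes≡mk (*-zeroʳ m))
    k<m : k < m
    k<m = *-cancelˡ-< m k m (subst (_< m * m) sizes≡mk sizes<m²)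
    kp≡ : r ℤ.* P ≡ + (k * p)
    kp≡ = trans (cong (ℤ._* P) (sym i≡r)) (sym (ℤ.pos-* k p))

-- A small multiple of a prime as a sum of squares, by pigeonhole

%-≡⇒∣∸ : ∀ u v p .{{_ : NonZero p}} → u % p ≡ v % p → p Div.∣ v ∸ u
%-≡⇒∣∸ u v p u≡v = divides (v / p ∸ u / p) (begin
  v ∸ u                                         ≡⟨ cong₂ _∸_ (m≡m%n+[m/n]*n v p) (m≡m%n+[m/n]*n u p) ⟩
  (v % p + v / p * p) ∸ (u % p + u / p * p)     ≡⟨ cong (λ r → (v % p + v / p * p) ∸ (r + u / p * p)) u≡v ⟩
  (v % p + v / p * p) ∸ (v % p + u / p * p)     ≡⟨ [m+n]∸[m+o]≡n∸o (v % p) _ _ ⟩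
  v / p * p ∸ u / p * p                         ≡⟨ *-distribʳ-∸ p (v / p) (u / p) ⟨
  (v / p ∸ u / p) * p                           ∎)
  where open ≡-Reasoning

-- The prime is `suc p`, so `p` serves as -1 modulo it. Names such as `2h≤p` and `p∤` refer to the
-- prime.
module _ {p} (p-prime : Prime (suc p)) where

  private
    h : ℕ
    h = suc p / 2

    2h≤p : h + h ≤ suc p
    2h≤p = ≤-trans (≤-reflexive (trans (cong (λ u → h + u) (sym (+-identityʳ h))) (*-comm 2 h))) (m/n*n≤m (suc p) 2)

    p<2+2h : suc p < suc h + suc h
    p<2+2h = begin-strict
      suc p               ≡⟨ m≡m%n+[m/n]*n (suc p) 2 ⟩
      suc p % 2 + h * 2   <⟨ +-monoˡ-< (h * 2) (m%n<n (suc p) 2) ⟩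
      2 + h * 2           ≡⟨ twice h ⟩
      suc h + suc h       ∎
      where
      open ≤-Reasoning
      twice : ∀ h → 2 + h * 2 ≡ suc h + suc h
      twice = solve-∀

    1<p : 1 < suc p
    1<p = nonTrivial⇒n>1 (suc p) {{prime⇒nonTrivial p-prime}}

    p∤ : ∀ {n} → 0 < n → n < suc p → ¬ (suc p Div.∣ n)
    p∤ {suc n} _ n<p p∣n = <⇒≱ n<p (∣⇒≤ p∣n)

    difference : ∀ a e → e * (a + (a + e)) + a * a ≡ (a + e) * (a + e)
    difference = solve-∀

    -- The product is (a + e)² - a²; both factors are positive and below the prime, as `a + e ≤ h`.
    p∤difference : ∀ a e → 0 < e → a + e ≤ h → ¬ (suc p Div.∣ e * (a + (a + e)))
    p∤difference a e 0<e a+e≤h p∣ with euclidsLemma e (a + (a + e)) p-prime p∣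
    ... | inj₁ p∣e = p∤ 0<e (≤-<-trans (m≤n+m e a) (≤-<-trans a+e≤h (<-≤-trans (m<m+n h 0<h) 2h≤p))) p∣e
      where 0<h = <-≤-trans 0<e (≤-trans (m≤n+m e a) a+e≤h)
    ... | inj₂ p∣s = p∤ (<-≤-trans 0<e (≤-trans (m≤n+m e a) (m≤n+m (a + e) a)))
      (<-≤-trans (+-mono-<-≤ (<-≤-trans (m<m+n a 0<e) a+e≤h) a+e≤h) 2h≤p) p∣s

    -- `value₂ b` represents -1 - b², so a common residue of the two families solves 1 + a² + b² ≡
    -- 0.
    value₁ value₂ : ℕ → ℕ
    value₁ a = a * a
    value₂ b = p * (1 + b * b)

    distinct : ∀ (v : ℕ → ℕ) → (∀ a e → 0 < e → a + e ≤ h → ¬ (suc p Div.∣ v (a + e) ∸ v a)) →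
      ∀ {a b} → a ≤ h → b ≤ h → v a % suc p ≡ v b % suc p → a ≡ b
    distinct v v-distinct {a} {b} a≤h b≤h va≡vb with <-cmp a b
    ... | tri≈ _ a≡b _ = a≡b
    ... | tri< a<b _ _ = contradiction (%-≡⇒∣∸ (v a) (v (a + (b ∸ a))) (suc p) (trans va≡vb (cong (λ u → v u % suc p) (sym b≡))))
      (v-distinct a (b ∸ a) (m<n⇒0<n∸m a<b) (≤-trans (≤-reflexive b≡) b≤h))
      where b≡ = m+[n∸m]≡n (<⇒≤ a<b)
    ... | tri> _ _ b<a = contradiction (%-≡⇒∣∸ (v b) (v (b + (a ∸ b))) (suc p) (trans (sym va≡vb) (cong (λ u → v u % suc p) (sym a≡))))
      (v-distinct b (a ∸ b) (m<n⇒0<n∸m b<a) (≤-trans (≤-reflexive a≡) a≤h))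
      where a≡ = m+[n∸m]≡n (<⇒≤ b<a)

    value₁-distinct : ∀ a e → 0 < e → a + e ≤ h → ¬ (suc p Div.∣ value₁ (a + e) ∸ value₁ a)
    value₁-distinct a e 0<e a+e≤h p∣ = p∤difference a e 0<e a+e≤h
      (subst (suc p Div.∣_) (trans (cong (_∸ a * a) (sym (difference a e))) (m+n∸n≡m _ (a * a))) p∣)

    value₂-distinct : ∀ a e → 0 < e → a + e ≤ h → ¬ (suc p Div.∣ value₂ (a + e) ∸ value₂ a)
    value₂-distinct a e 0<e a+e≤h p∣
      with euclidsLemma p (e * (a + (a + e))) p-prime (subst (suc p Div.∣_)
        (trans (sym (*-distribˡ-∸ p (1 + (a + e) * (a + e)) (1 + a * a)))
               (cong (p *_) (trans (cong (_∸ a * a) (sym (difference a e))) (m+n∸n≡m _ (a * a))))) p∣)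
    ... | inj₁ p∣p-1 = p∤ (s≤s⁻¹ 1<p) ≤-refl p∣p-1
    ... | inj₂ p∣d   = p∤difference a e 0<e a+e≤h p∣d

    value : Fin (suc h) ⊎ Fin (suc h) → ℕ
    value (inj₁ a) = value₁ (toℕ a)
    value (inj₂ b) = value₂ (toℕ b)

    Solution : Set
    Solution = ∃₂ λ a b → a ≤ h × b ≤ h × suc p Div.∣ 1 + a * a + b * b

    cross : ∀ {a b} → a ≤ h → b ≤ h → value₁ a % suc p ≡ value₂ b % suc p → Solution
    cross {a} {b} a≤h b≤h eq = a , b , a≤h , b≤h , m%n≡0⇒n∣m (1 + a * a + b * b) (suc p) (begin
      (1 + a * a + b * b) % suc p                 ≡⟨ cong (_% suc p) (reorder (a * a) (b * b)) ⟩
      (a * a + w) % suc p                         ≡⟨ %-distribˡ-+ (a * a) w (suc p) ⟩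
      (a * a % suc p + w % suc p) % suc p         ≡⟨ cong (λ u → (u + w % suc p) % suc p) eq ⟩
      (p * w % suc p + w % suc p) % suc p         ≡⟨ %-distribˡ-+ (p * w) w (suc p) ⟨
      (p * w + w) % suc p                         ≡⟨ cong (_% suc p) (trans (+-comm (p * w) w) (*-comm (suc p) w)) ⟩
      w * suc p % suc p                           ≡⟨ m*n%n≡0 w (suc p) ⟩
      0                                           ∎)
      where
      open ≡-Reasoning
      w = 1 + b * b
      reorder : ∀ s t → 1 + s + t ≡ s + (1 + t)
      reorder = solve-∀

    bound : (a : Fin (suc h)) → toℕ a ≤ h
    bound a = s≤s⁻¹ (toℕ<n a)

    -- The `suc h + suc h` arguments outnumber the residues, and each family is injective modulo the
    -- prime on 0, ..., h; the collision must be between the two families.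
    solution : Solution
    solution with pigeonhole p<2+2h (λ i → fromℕ< (m%n<n (value (splitAt (suc h) i)) (suc p)))
    ... | i , j , i<j , fi≡fj
      with splitAt (suc h) i in i≡ | splitAt (suc h) j in j≡ | fromℕ<-injective _ _ _ _ fi≡fj
    ... | inj₁ a | inj₂ b | eq = cross (bound a) (bound b) eq
    ... | inj₂ b | inj₁ a | eq = cross (bound a) (bound b) (sym eq)
    ... | inj₁ a | inj₁ b | eq = contradiction
      (trans (sym (splitAt⁻¹-↑ˡ i≡)) (trans (cong (_↑ˡ suc h) (toℕ-injective (distinct value₁ value₁-distinct (bound a) (bound b) eq))) (splitAt⁻¹-↑ˡ j≡)))
      (Fin.<⇒≢ i<j)
    ... | inj₂ a | inj₂ b | eq = contradiction
      (trans (sym (splitAt⁻¹-↑ʳ i≡)) (trans (cong (suc h ↑ʳ_) (toℕ-injective (distinct value₂ value₂-distinct (bound a) (bound b) eq))) (splitAt⁻¹-↑ʳ j≡)))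
      (Fin.<⇒≢ i<j)

  -- Twice 1 + a² + b² is at most 2 plus the square of the prime, because a and b are at most half
  -- of it; hence the cofactor stays below the prime.
  smallMultiple : ∃ λ m → 0 < m × m < suc p × FourSquares (m * suc p)
  smallMultiple with solution
  ... | a , b , a≤h , b≤h , divides m eq = m , n≢0⇒n>0 m≢0 , m<p , a , b , 1 , 0 , trans (sym eq) (reorder a b)
    where
    reorder : ∀ a b → 1 + a * a + b * b ≡ a * a + b * b + 1 * 1 + 0 * 0
    reorder = solve-∀
    m≢0 : m ≢ 0
    m≢0 m≡0 = 1+n≢0 (trans eq (cong (_* suc p) m≡0))
    m<p : m < suc p
    m<p = *-cancelʳ-< (suc p) m (suc p) (*-cancelˡ-< 2 (m * suc p) (suc p * suc p) (begin-strict
      2 * (m * suc p)                         ≡⟨ cong (2 *_) eq ⟨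
      2 * (1 + a * a + b * b)                 ≤⟨ *-monoʳ-≤ 2 (+-mono-≤ (s≤s (*-mono-≤ a≤h a≤h)) (*-mono-≤ b≤h b≤h)) ⟩
      2 * (1 + h * h + h * h)                 ≡⟨ quadruple h ⟩
      2 + (h + h) * (h + h)                   ≤⟨ +-monoʳ-≤ 2 (*-mono-≤ 2h≤p 2h≤p) ⟩
      2 + suc p * suc p                       <⟨ +-monoˡ-< (suc p * suc p) 2<p² ⟩
      suc p * suc p + suc p * suc p           ≡⟨ cong (λ u → suc p * suc p + u) (+-identityʳ (suc p * suc p)) ⟨
      2 * (suc p * suc p)                     ∎))
      where
      open ≤-Reasoning
      quadruple : ∀ h → 2 * (1 + h * h + h * h) ≡ 2 + (h + h) * (h + h)
      quadruple = solve-∀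
      2<p² : 2 < suc p * suc p
      2<p² = ≤-trans (s≤s (s≤s (s≤s z≤n))) (*-mono-≤ 1<p 1<p)

multiple⇒FourSquares : ∀ {p} → Prime p → ∀ m → 0 < m → m < p → FourSquares (m * p) → FourSquares p
multiple⇒FourSquares {p} p-prime = <-rec (λ m → 0 < m → m < p → FourSquares (m * p) → FourSquares p) step
  where
  step : ∀ m → (∀ {r} → r < m → 0 < r → r < p → FourSquares (r * p) → FourSquares p) →
    0 < m → m < p → FourSquares (m * p) → FourSquares p
  step 1 _ _ _ 1p = subst FourSquares (*-identityˡ p) 1p
  step m@(suc (suc _)) rec _ m<p mp = continue (descend p-prime m (s≤s (s≤s z≤n)) m<p mp)
    where
    continue : (∃ λ r → 0 < r × r < m × FourSquares (r * p)) → FourSquares p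
    continue (r , 0<r , r<m , rp) = rec r<m 0<r (<-trans r<m m<p) rp

prime⇒FourSquares : ∀ {p} → Prime p → FourSquares p
prime⇒FourSquares {zero}  _       = 0 , 0 , 0 , 0 , refl
prime⇒FourSquares {suc p} p-prime = conclude (smallMultiple p-prime)
  where
  conclude : (∃ λ m → 0 < m × m < suc p × FourSquares (m * suc p)) → FourSquares (suc p)
  conclude (m , 0<m , m<p , mp) = multiple⇒FourSquares p-prime m 0<m m<p mp

-- Euler's identity reduces the claim to the prime factors.
lagrange : ∀ n → FourSquares n
lagrange zero      = 0 , 0 , 0 , 0 , refl
lagrange n@(suc _) = subst FourSquares (sym isFactorisation) (products factorsPrime)
  where
  open PrimeFactorisation (factorise n)
  products : ∀ {ps} → All Prime ps → FourSquares (product ps)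
  products []       = 1 , 0 , 0 , 0 , refl
  products (p ∷ ps) = FourSquares-* (prime⇒FourSquares p) (products ps)

-- Large n

-- Explicit witnesses for what `parts` counts, with bases in non-increasing order; one witness shows
-- that a count is positive.
data Partition : ℕ → ℕ → ℕ → Set where
  []   : ∀ {b} → Partition 0 b 0
  part : ∀ {j b m n} k → 1 ≤ k → k ≤ b → Partition j k m → n ≡ k * k + m → Partition (suc j) b n

weaken : ∀ {j b c n} → b ≤ c → Partition j b n → Partition j c n
weaken b≤c []                     = []
weaken b≤c (part k 1≤k k≤b p n≡) = part k 1≤k (≤-trans k≤b b≤c) p n≡

insert : ∀ {j b n} a → 1 ≤ a → a ≤ b → Partition j b n → Partition (suc j) b (a * a + n)
insert a 1≤a a≤b [] = part a 1≤a a≤b [] refl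
insert a 1≤a a≤b (part {m = m} k 1≤k k≤b p refl) with ≤-total k a
... | inj₁ k≤a = part a 1≤a a≤b (part k 1≤k k≤a p refl) refl
... | inj₂ a≤k = part k 1≤k k≤b (insert a 1≤a a≤k p) (swap (a * a) (k * k) m)
  where
  swap : ∀ s t m → s + (t + m) ≡ t + (s + m)
  swap = solve-∀

Partition⇒parts : ∀ {j b n} → Partition j b n → 1 ≤ parts j b n
Partition⇒parts []                                     = ≤-refl
Partition⇒parts {suc j} (part {m = m} k 1≤k k≤b p refl) = begin
  1                             ≤⟨ Partition⇒parts p ⟩
  parts j k m                   ≡⟨ shift-+ˡ (k * k) (parts j k) m ⟨
  withLargest j k (k * k + m)   ≤⟨ withLargest≤parts j (k * k + m) 1≤k k≤b ⟩
  _                             ∎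
  where open ≤-Reasoning

√≤ : ∀ {a b} → a * a ≤ b * b → a ≤ b
√≤ {a} {b} a²≤b² with a ≤? b
... | yes a≤b = a≤b
... | no  a≰b = contradiction a²≤b² (<⇒≱ (*-mono-< (≰⇒> a≰b) (≰⇒> a≰b)))

AtMost : ℕ → ℕ → ℕ → Set
AtMost i b n = ∃ λ j → j ≤ i × Partition j b n

insertSquare : ∀ {i b n} a → a * a ≤ b * b → AtMost i b n → AtMost (suc i) b (a * a + n)
insertSquare zero      _     (j , j≤i , p) = j , m≤n⇒m≤1+n j≤i , p
insertSquare a@(suc _) a²≤b² (j , j≤i , p) = suc j , s≤s j≤i , insert a (s≤s z≤n) (√≤ a²≤b²) p

-- Lagrange's zero squares are dropped and the others sorted; a base is at most `b` because its
-- square is at most `m ≤ b * b`.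
atMostFour : ∀ b m → m ≤ b * b → AtMost 4 b m
atMostFour b m m≤b² = build (lagrange m)
  where
  build : FourSquares m → AtMost 4 b m
  build (x , y , z , w , m≡) = subst (AtMost 4 b) (sym m≡′)
    (insertSquare x (≤-trans x≤ total≤) (insertSquare y (≤-trans y≤ total≤)
      (insertSquare z (≤-trans z≤ total≤) (insertSquare w (≤-trans w≤ total≤) (0 , z≤n , [])))))
    where
    total : ℕ
    total = x * x + (y * y + (z * z + (w * w + 0)))
    reorder : ∀ s t u v → s + t + u + v ≡ s + (t + (u + (v + 0)))
    reorder = solve-∀
    m≡′ : m ≡ total
    m≡′ = trans m≡ (reorder (x * x) (y * y) (z * z) (w * w))
    total≤ : total ≤ b * b
    total≤ = ≤-trans (≤-reflexive (sym m≡′)) m≤b²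
    x≤ : x * x ≤ total
    x≤ = m≤m+n _ _
    y≤ : y * y ≤ total
    y≤ = m≤n⇒m≤o+n (x * x) (m≤m+n _ _)
    z≤ : z * z ≤ total
    z≤ = m≤n⇒m≤o+n (x * x) (m≤n⇒m≤o+n (y * y) (m≤m+n _ _))
    w≤ : w * w ≤ total
    w≤ = m≤n⇒m≤o+n (x * x) (m≤n⇒m≤o+n (y * y) (m≤n⇒m≤o+n (z * z) (m≤m+n _ _)))

partition⇒withLargest : ∀ {j m n} k → n ≡ k * k + m → Partition j k m → 1 ≤ withLargest j k n
partition⇒withLargest {j} {m} k refl p =
  ≤-trans (Partition⇒parts p) (≤-reflexive (sym (shift-+ˡ (k * k) (parts j k) m)))

-- If the remainder `m` takes i squares, (13 t)² is split into 5 - i squares, for a total of five.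
-- The bound on `m` keeps its bases within 10 t, so the largest base is 10 t, 12 t or 13 t.
split169 : ∀ t m n → 1 ≤ t → n ≡ 169 * (t * t) + m → 1 ≤ m → m ≤ 100 * (t * t) →
  1 ≤ withLargest 4 (10 * t) n + withLargest 4 (12 * t) n + withLargest 4 (13 * t) n
split169 t m n 1≤t n≡ 1≤m m≤ = split (atMostFour (10 * t) m (≤-trans m≤ (≤-reflexive (square₁₀ t))))
  where
  scale : ∀ c .{{_ : NonZero c}} → 1 ≤ c * t
  scale c = ≤-trans 1≤t (m≤n*m t c)
  square₁₀ : ∀ t → 100 * (t * t) ≡ 10 * t * (10 * t)
  square₁₀ = solve-∀
  decompose₁ : ∀ t m → 169 * (t * t) + m ≡
    10 * t * (10 * t) + (8 * t * (8 * t) + (2 * t * (2 * t) + (1 * t * (1 * t) + m)))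
  decompose₁ = solve-∀
  decompose₂ : ∀ t m → 169 * (t * t) + m ≡ 12 * t * (12 * t) + (4 * t * (4 * t) + (3 * t * (3 * t) + m))
  decompose₂ = solve-∀
  decompose₃ : ∀ t m → 169 * (t * t) + m ≡ 12 * t * (12 * t) + (5 * t * (5 * t) + m)
  decompose₃ = solve-∀
  decompose₄ : ∀ t m → 169 * (t * t) + m ≡ 13 * t * (13 * t) + m
  decompose₄ = solve-∀
  split : AtMost 4 (10 * t) m →
    1 ≤ withLargest 4 (10 * t) n + withLargest 4 (12 * t) n + withLargest 4 (13 * t) n
  split (0 , _ , p) = contradiction p (empty 1≤m)
    where
    empty : ∀ {b m} → 1 ≤ m → ¬ Partition 0 b m
    empty () []
  split (1 , _ , p) = m≤n⇒m≤n+o _ (m≤n⇒m≤n+o _ (partition⇒withLargest (10 * t) (trans n≡ (decompose₁ t m))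
    (insert (8 * t) (scale 8) (*-monoˡ-≤ t (≤ᵇ⇒≤ 8 10 tt)) (insert (2 * t) (scale 2) (*-monoˡ-≤ t (≤ᵇ⇒≤ 2 10 tt))
      (insert (1 * t) (scale 1) (*-monoˡ-≤ t (≤ᵇ⇒≤ 1 10 tt)) p)))))
  split (2 , _ , p) = m≤n⇒m≤n+o _ (m≤n⇒m≤o+n (withLargest 4 (10 * t) n) (partition⇒withLargest (12 * t) (trans n≡ (decompose₂ t m))
    (insert (4 * t) (scale 4) (*-monoˡ-≤ t (≤ᵇ⇒≤ 4 12 tt)) (insert (3 * t) (scale 3) (*-monoˡ-≤ t (≤ᵇ⇒≤ 3 12 tt))
      (weaken (*-monoˡ-≤ t (≤ᵇ⇒≤ 10 12 tt)) p)))))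
  split (3 , _ , p) = m≤n⇒m≤n+o _ (m≤n⇒m≤o+n (withLargest 4 (10 * t) n) (partition⇒withLargest (12 * t) (trans n≡ (decompose₃ t m))
    (insert (5 * t) (scale 5) (*-monoˡ-≤ t (≤ᵇ⇒≤ 5 12 tt)) (weaken (*-monoˡ-≤ t (≤ᵇ⇒≤ 10 12 tt)) p))))
  split (4 , _ , p) = m≤n⇒m≤o+n _ (partition⇒withLargest (13 * t) (trans n≡ (decompose₄ t m))
    (weaken (*-monoˡ-≤ t (≤ᵇ⇒≤ 10 13 tt)) p))
  split (suc (suc (suc (suc (suc _)))) , s≤s (s≤s (s≤s (s≤s ()))) , _)

sumTo : (ℕ → ℕ) → ℕ → ℕ
sumTo g zero    = 0
sumTo g (suc l) = g (suc l) + sumTo g l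

-- Telescoping over the distinct largest bases c (s + 1), ..., c (s + l).
sumTo-withLargest : ∀ j c .{{_ : NonZero c}} s l n →
  sumTo (λ i → withLargest j (c * (s + i)) n) l + parts (suc j) (c * s) n ≤ parts (suc j) (c * (s + l)) n
sumTo-withLargest j c s zero    n = ≤-reflexive (cong (λ u → parts (suc j) (c * u) n) (sym (+-identityʳ s)))
sumTo-withLargest j c s (suc l) n = begin
  W + sumTo g l + parts (suc j) (c * s) n   ≡⟨ +-assoc W (sumTo g l) _ ⟩
  W + (sumTo g l + parts (suc j) (c * s) n) ≤⟨ +-monoʳ-≤ W (sumTo-withLargest j c s l n) ⟩
  W + parts (suc j) (c * (s + l)) n         ≤⟨ withLargest+parts≤parts j n (*-monoʳ-< c (+-monoʳ-< s (n<1+n l))) ⟩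
  parts (suc j) (c * (s + suc l)) n         ∎
  where
  open ≤-Reasoning
  g : ℕ → ℕ
  g i = withLargest j (c * (s + i)) n
  W = g (suc l)

sumTo-≥ : ∀ f g h l → (∀ i → 1 ≤ i → i ≤ l → 1 ≤ f i + g i + h i) → l ≤ sumTo f l + sumTo g l + sumTo h l
sumTo-≥ f g h zero    _  = z≤n
sumTo-≥ f g h (suc l) 1≤ = ≤-trans
  (+-mono-≤ (1≤ (suc l) (s≤s z≤n) ≤-refl) (sumTo-≥ f g h l (λ i 1≤i i≤l → 1≤ i 1≤i (m≤n⇒m≤1+n i≤l))))
  (≤-reflexive (interchange (f (suc l)) (g (suc l)) (h (suc l)) (sumTo f l) (sumTo g l) (sumTo h l)))
  where
  interchange : ∀ a b c x y z → a + b + c + (x + y + z) ≡ a + x + (b + y) + (c + z)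
  interchange = solve-∀

-- For s < t ≤ s + l the candidate largest parts 10 t, 12 t, 13 t fall into three
-- disjoint ranges, so distinct t give distinct partitions.
manyPartitions : ∀ s l n → 12 * l ≤ s → 169 * ((s + l) * (s + l)) < n → n ≤ 269 * (suc s * suc s) → l ≤ parts 5 n n
manyPartitions s l n 12l≤s lower upper = begin
  l                                 ≤⟨ sumTo-≥ (W 10) (W 12) (W 13) l each ⟩
  Σ₁₀ + Σ₁₂ + Σ₁₃                   ≤⟨ +-monoˡ-≤ Σ₁₃ (+-monoˡ-≤ Σ₁₂ (m≤m+n Σ₁₀ _)) ⟩
  Σ₁₀ + p (10 * s) + Σ₁₂ + Σ₁₃      ≤⟨ +-monoˡ-≤ Σ₁₃ (+-monoˡ-≤ Σ₁₂ (sumTo-withLargest 4 10 s l n)) ⟩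
  p (10 * (s + l)) + Σ₁₂ + Σ₁₃      ≤⟨ +-monoˡ-≤ Σ₁₃ (+-monoˡ-≤ Σ₁₂ (parts-mono 5 10≤12 n)) ⟩
  p (12 * s) + Σ₁₂ + Σ₁₃            ≡⟨ cong (_+ Σ₁₃) (+-comm (p (12 * s)) Σ₁₂) ⟩
  Σ₁₂ + p (12 * s) + Σ₁₃            ≤⟨ +-monoˡ-≤ Σ₁₃ (sumTo-withLargest 4 12 s l n) ⟩
  p (12 * (s + l)) + Σ₁₃            ≤⟨ +-monoˡ-≤ Σ₁₃ (parts-mono 5 12≤13 n) ⟩
  p (13 * s) + Σ₁₃                  ≡⟨ +-comm (p (13 * s)) Σ₁₃ ⟩
  Σ₁₃ + p (13 * s)                  ≤⟨ sumTo-withLargest 4 13 s l n ⟩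
  p (13 * (s + l))                  ≤⟨ parts-mono 5 13≤n n ⟩
  p n                               ∎
  where
  open ≤-Reasoning
  W : ℕ → ℕ → ℕ
  W c i = withLargest 4 (c * (s + i)) n
  Σ₁₀ Σ₁₂ Σ₁₃ : ℕ
  Σ₁₀ = sumTo (W 10) l
  Σ₁₂ = sumTo (W 12) l
  Σ₁₃ = sumTo (W 13) l
  p : ℕ → ℕ
  p b = parts 5 b n
  -- Here 12 l ≤ s separates the ranges of the largest bases 12 t and 13 t.
  12≤13 : 12 * (s + l) ≤ 13 * s
  12≤13 = ≤-trans (≤-reflexive (*-distribˡ-+ 12 s l))
    (≤-trans (+-monoʳ-≤ (12 * s) 12l≤s) (≤-reflexive (+-comm (12 * s) s)))
  10≤12 : 10 * (s + l) ≤ 12 * s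
  10≤12 = ≤-trans (≤-reflexive (*-distribˡ-+ 10 s l))
    (≤-trans (+-monoʳ-≤ (10 * s) (≤-trans (*-monoˡ-≤ l (≤ᵇ⇒≤ 10 12 tt)) (≤-trans 12l≤s (m≤m+n s s))))
             (≤-reflexive (regroup s)))
    where
    regroup : ∀ s → 10 * s + (s + s) ≡ 12 * s
    regroup = solve-∀
  13≤n : 13 * (s + l) ≤ n
  13≤n = ≤-trans (m≤m² (13 * (s + l))) (≤-trans (≤-reflexive (square₁₃ (s + l))) (<⇒≤ lower))
    where
    m≤m² : ∀ m → m ≤ m * m
    m≤m² zero        = z≤n
    m≤m² m@(suc _) = m≤m*n m m
    square₁₃ : ∀ u → 13 * u * (13 * u) ≡ 169 * (u * u)
    square₁₃ = solve-∀
  each : ∀ i → 1 ≤ i → i ≤ l → 1 ≤ W 10 i + W 12 i + W 13 i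
  each i 1≤i i≤l = split169 t (n ∸ 169 * (t * t)) n (≤-trans 1≤i (m≤n+m i s))
    (sym (m+[n∸m]≡n (<⇒≤ 169t²<n))) (m<n⇒0<n∸m 169t²<n) (m≤n+o⇒m∸n≤o n (169 * (t * t)) (begin
      n                               ≤⟨ upper ⟩
      -- 269 = 169 + 100: what remains after (13 t)² must not exceed (10 t)².
      269 * (suc s * suc s)           ≤⟨ *-monoʳ-≤ 269 (*-mono-≤ s<t s<t) ⟩
      269 * (t * t)                   ≡⟨ *-distribʳ-+ (t * t) 169 100 ⟩
      169 * (t * t) + 100 * (t * t)   ∎))
    where
    t = s + i
    s<t : s < t
    s<t = m<m+n s 1≤i
    t≤ : t ≤ s + l
    t≤ = +-monoʳ-≤ s i≤l
    169t²<n : 169 * (t * t) < n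
    169t²<n = ≤-<-trans (*-monoʳ-≤ 169 (*-mono-≤ t≤ t≤)) lower

squareRoot : ∀ n → ∃ λ r → r * r ≤ n × n < suc r * suc r
squareRoot zero = 0 , z≤n , s≤s z≤n
squareRoot (suc n) with squareRoot n
... | r , r²≤n , n<r² with suc n <? suc r * suc r
...   | yes n<r²′ = r , m≤n⇒m≤1+n r²≤n , n<r²′
...   | no  n≮r²  = suc r , ≮⇒≥ n≮r² , <-≤-trans (s≤s n<r²) (*-mono-< (n<1+n (suc r)) (n<1+n (suc r)))

-- With r = ⌊√(n / 169)⌋ and s = r - 498, the threshold r ≥ 6474 = 13 · 498 gives s ≥ 5976 = 12 ·
-- 498, the room required for 498 values of t. Passing to the successor of `n` makes the lower bound
-- strict.
498≤parts-large : ∀ n → 169 * (6474 * 6474) ≤ n → 498 ≤ parts 5 (suc n) (suc n)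
498≤parts-large n n≥ = manyPartitions s 498 (suc n) (≤-trans (≤ᵇ⇒≤ (12 * 498) 5976 tt) 5976≤s) lower upper
  where
  r : ℕ
  r = proj₁ (squareRoot (n / 169))
  r²≤ : r * r ≤ n / 169
  r²≤ = proj₁ (proj₂ (squareRoot (n / 169)))
  <r² : n / 169 < suc r * suc r
  <r² = proj₂ (proj₂ (squareRoot (n / 169)))
  6474≤r : 6474 ≤ r
  6474≤r = s≤s⁻¹ (√< (≤-<-trans (≤-trans (≤-reflexive (sym (m*n/n≡m (6474 * 6474) 169)))
    (/-monoˡ-≤ 169 (≤-trans (≤-reflexive (*-comm (6474 * 6474) 169)) n≥))) <r²))
    where
    √< : ∀ {a b} → a * a < b * b → a < b
    √< a²<b² = ≰⇒> λ b≤a → <⇒≱ a²<b² (*-mono-≤ b≤a b≤a)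
  s : ℕ
  s = r ∸ 498
  s+498≡r : s + 498 ≡ r
  s+498≡r = m∸n+n≡m (≤-trans (≤ᵇ⇒≤ 498 6474 tt) 6474≤r)
  5976≤s : 5976 ≤ s
  5976≤s = ∸-monoˡ-≤ 498 6474≤r
  lower : 169 * ((s + 498) * (s + 498)) < suc n
  lower = s≤s (≤-trans (≤-reflexive (trans (cong (λ u → 169 * (u * u)) s+498≡r) (*-comm 169 (r * r))))
    (≤-trans (*-monoˡ-≤ 169 r²≤) (m/n*n≤m n 169)))
  -- As 6474 ≤ 3 · 5976, the root of the upper bound is at most 16 (s + 1), and 16² = 256 fits below
  -- 269.
  13≤16 : 13 * (suc s + 498) ≤ 16 * suc s
  13≤16 = begin
    13 * (suc s + 498)      ≡⟨ *-distribˡ-+ 13 (suc s) 498 ⟩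
    13 * suc s + 6474       ≤⟨ +-monoʳ-≤ (13 * suc s) (≤-trans (≤ᵇ⇒≤ 6474 (3 * 5976) tt) (*-monoʳ-≤ 3 (m≤n⇒m≤1+n 5976≤s))) ⟩
    13 * suc s + 3 * suc s  ≡⟨ *-distribʳ-+ (suc s) 13 3 ⟨
    16 * suc s              ∎
    where open ≤-Reasoning
  upper : suc n ≤ 269 * (suc s * suc s)
  upper = begin
    suc n                                       ≤⟨ m/n<o⇒m<o*n ⟩
    suc r * suc r * 169                         ≡⟨ cong (λ u → suc u * suc u * 169) s+498≡r ⟨
    (suc s + 498) * (suc s + 498) * 169         ≡⟨ square₁₃ (suc s + 498) ⟩
    13 * (suc s + 498) * (13 * (suc s + 498))   ≤⟨ *-mono-≤ 13≤16 13≤16 ⟩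
    16 * suc s * (16 * suc s)                   ≡⟨ square₁₆ (suc s) ⟩
    256 * (suc s * suc s)                       ≤⟨ *-monoˡ-≤ (suc s * suc s) (≤ᵇ⇒≤ 256 269 tt) ⟩
    269 * (suc s * suc s)                       ∎
    where
    open ≤-Reasoning
    square₁₃ : ∀ u → u * u * 169 ≡ 13 * u * (13 * u)
    square₁₃ = solve-∀
    square₁₆ : ∀ u → 16 * u * (16 * u) ≡ 256 * (u * u)
    square₁₆ = solve-∀
    m/n<o⇒m<o*n : n < suc r * suc r * 169
    m/n<o⇒m<o*n = begin-strict
      n                         ≡⟨ m≡m%n+[m/n]*n n 169 ⟩
      n % 169 + n / 169 * 169   <⟨ +-monoˡ-< (n / 169 * 169) (m%n<n n 169) ⟩
      suc (n / 169) * 169       ≤⟨ *-monoˡ-≤ 169 <r² ⟩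
      suc r * suc r * 169       ∎

-- Medium n

-- 11928 = 4! · 497. At the odd number 25121 the bound still fails.
oddLarge : ℕ → ℕ → Bool
oddLarge i d = if 25200 ≤ᵇ i then (if i % 2 ≡ᵇ 1 then 11928 <ᵇ d else true) else true

oddLarge⇒> : ∀ i d → 25200 ≤ i → i % 2 ≡ 1 → oddLarge i d ≡ true → 11928 < d
oddLarge⇒> i d i≥ odd ok with 25200 ≤ᵇ i | ≤⇒≤ᵇ i≥ | i % 2 ≡ᵇ 1 | ≡⇒≡ᵇ (i % 2) 1 odd
... | true | _ | true | _ = <ᵇ⇒< 11928 d (Equivalence.from T-≡ ok)

-- The digits are at most 627⁴ < 2³⁸, and 393216 = 48 · 2¹³ ≤ 628².
ordered-odd : ∀ m → 25200 ≤ m → m < 393216 → m % 2 ≡ 1 → 11928 < ordered 4 627 m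
ordered-odd m m≥ m< odd = oddLarge⇒> m (ordered 4 627 m) m≥ odd
  (Packed.Scan.scan-ordered₄ 274877906944 oddLarge 48 13 627 (<ᵇ⇒< (627 ^ 4) 274877906944 tt) refl m<)

-- Dividing the ordered count by 4! = 24 leaves more than 497, and m < 393216 ≤ 628² allows the
-- bound 627 to be exchanged for `k`.
498≤parts₄ : ∀ m k → 25200 ≤ m → m < 393216 → m % 2 ≡ 1 → m < suc k * suc k → 498 ≤ parts 4 k m
498≤parts₄ m k m≥ m< odd m<k² = begin
  498           ≤⟨ *-cancelˡ-< 24 497 (parts 4 627 m) (<-≤-trans (ordered-odd m m≥ m< odd) (ordered≤!*parts 4 627 m)) ⟩
  parts 4 627 m ≡⟨ parts-bound-irrelevant 3 {627} {k} (<-≤-trans m< (≤ᵇ⇒≤ 393216 (628 * 628) tt)) m<k² ⟩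
  parts 4 k m   ∎
  where open ≤-Reasoning

even⇒suc-odd : ∀ m → m % 2 ≡ 0 → suc m % 2 ≡ 1
even⇒suc-odd m m-even = trans (%-distribˡ-+ 1 m 2) (cong (λ u → (1 + u) % 2) m-even)

-- One of the two largest k with n − k² ≥ 25200 leaves an odd remainder.
oddRemainder : ∀ n → 65536 ≤ n → n ≤ 169 * (6474 * 6474) →
  ∃₂ λ k m → n ≡ k * k + m × 1 ≤ k × 25200 ≤ m × m < 393216 × m % 2 ≡ 1 × m < suc k * suc k
oddRemainder n n≥ n≤ = choose (m % 2) refl (m%n<n m 2)
  where
  open ≤-Reasoning
  x r e m : ℕ
  x = n ∸ 25200
  r = proj₁ (squareRoot x)
  e = x ∸ r * r
  m = e + 25200
  r²≤x : r * r ≤ x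
  r²≤x = proj₁ (proj₂ (squareRoot x))
  x<r² : x < suc r * suc r
  x<r² = proj₂ (proj₂ (squareRoot x))
  n≡r²+m : n ≡ r * r + m
  n≡r²+m = begin-equality
    n                     ≡⟨ m∸n+n≡m (≤-trans (≤ᵇ⇒≤ 25200 65536 tt) n≥) ⟨
    x + 25200             ≡⟨ cong (_+ 25200) (m+[n∸m]≡n r²≤x) ⟨
    r * r + e + 25200     ≡⟨ +-assoc (r * r) e 25200 ⟩
    r * r + m             ∎
  -- 200² = 40000 is at most 65536 - 25200 = 40336.
  200≤r : 200 ≤ r
  200≤r = ≮⇒≥ λ r<200 → <⇒≱ (<-≤-trans x<r² (*-mono-≤ r<200 r<200))
    (≤-trans (≤ᵇ⇒≤ (200 * 200) (65536 ∸ 25200) tt) (∸-monoˡ-≤ 25200 n≥))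
  -- The root is at most 13 · 6474 = 84162; the rounder 92000 still leaves 4 · 92000 + 25200 below
  -- 393216.
  r≤92000 : r ≤ 92000
  r≤92000 = √≤ (≤-trans r²≤x (≤-trans (m∸n≤m n 25200)
    (≤-trans n≤ (≤ᵇ⇒≤ (169 * (6474 * 6474)) (92000 * 92000) tt))))
  e≤2r : e ≤ 2 * r
  e≤2r = m≤n+o⇒m∸n≤o x (r * r) (s≤s⁻¹ (≤-trans x<r² (≤-reflexive (expand r))))
    where
    expand : ∀ r → suc r * suc r ≡ suc (r * r + 2 * r)
    expand = solve-∀
  m≤2r : m ≤ 2 * r + 25200
  m≤2r = +-monoˡ-≤ 25200 e≤2r
  m≤4r : m ≤ 4 * r + 25200
  m≤4r = ≤-trans m≤2r (+-monoˡ-≤ 25200 (*-monoˡ-≤ r (≤ᵇ⇒≤ 2 4 tt)))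
  -- This puts either remainder below the square of `r`, hence below that of `suc k` for both
  -- choices of `k`.
  4r<r² : 4 * r + 25200 < r * r
  4r<r² = begin-strict
    4 * r + 25200       <⟨ +-monoʳ-< (4 * r) (<ᵇ⇒< 25200 (196 * 200) tt) ⟩
    4 * r + 196 * 200   ≤⟨ +-monoʳ-≤ (4 * r) (*-monoʳ-≤ 196 200≤r) ⟩
    4 * r + 196 * r     ≡⟨ *-distribʳ-+ r 4 196 ⟨
    200 * r             ≤⟨ *-monoˡ-≤ r 200≤r ⟩
    r * r               ∎
  4r<393216 : 4 * r + 25200 < 393216
  4r<393216 = ≤-<-trans (+-monoˡ-≤ 25200 (*-monoʳ-≤ 4 r≤92000)) (<ᵇ⇒< (4 * 92000 + 25200) 393216 tt)
  -- Lowering the base by one adds the odd number 2 r - 1 to the remainder, which flips its parity.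
  r′ m′ : ℕ
  r′ = pred r
  m′ = suc (m + r′ * 2)
  r≡ : suc r′ ≡ r
  r≡ = suc-pred r {{>-nonZero (≤-trans (≤ᵇ⇒≤ 1 200 tt) 200≤r)}}
  m′≤4r : m′ ≤ 4 * r + 25200
  m′≤4r = begin
    m′                        ≤⟨ n≤1+n m′ ⟩
    2 + (m + r′ * 2)          ≡⟨ carry m r′ ⟩
    m + suc r′ * 2            ≡⟨ cong (λ u → m + u * 2) r≡ ⟩
    m + r * 2                 ≤⟨ +-monoˡ-≤ (r * 2) m≤2r ⟩
    2 * r + 25200 + r * 2     ≡⟨ collect r 25200 ⟩
    4 * r + 25200             ∎
    where
    carry : ∀ m r → 2 + (m + r * 2) ≡ m + suc r * 2
    carry = solve-∀
    collect : ∀ r c → 2 * r + c + r * 2 ≡ 4 * r + c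
    collect = solve-∀
  n≡r′²+m′ : n ≡ r′ * r′ + m′
  n≡r′²+m′ = trans n≡r²+m (trans (cong (λ u → u * u + m) (sym r≡)) (regroup r′ m))
    where
    regroup : ∀ r m → suc r * suc r + m ≡ r * r + suc (m + r * 2)
    regroup = solve-∀
  choose : ∀ b → m % 2 ≡ b → b < 2 →
    ∃₂ λ k m → n ≡ k * k + m × 1 ≤ k × 25200 ≤ m × m < 393216 × m % 2 ≡ 1 × m < suc k * suc k
  choose 1 odd _ = r , m , n≡r²+m , ≤-trans (≤ᵇ⇒≤ 1 200 tt) 200≤r , m≤n+m 25200 e ,
    ≤-<-trans m≤4r 4r<393216 , odd , <-trans (≤-<-trans m≤4r 4r<r²) (*-mono-< (n<1+n r) (n<1+n r))
  choose 0 even _ = r′ , m′ , n≡r′²+m′ , s≤s⁻¹ (≤-trans (≤ᵇ⇒≤ 2 200 tt) (≤-trans 200≤r (≤-reflexive (sym r≡)))) ,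
    ≤-trans (m≤n+m 25200 e) (m≤n⇒m≤1+n (m≤m+n m (r′ * 2))) , ≤-<-trans m′≤4r 4r<393216 ,
    even⇒suc-odd (m + r′ * 2) (trans ([m+kn]%n≡m%n m r′ 2) even) ,
    subst (λ u → m′ < u * u) (sym r≡) (≤-<-trans m′≤4r 4r<r²)
  choose (suc (suc _)) _ (s≤s (s≤s ()))

-- `k` can head every partition of `m` into four squares, whose bases are at most `k` because m < (k
-- + 1)².
498≤parts-medium : ∀ n → 65536 ≤ n → n ≤ 169 * (6474 * 6474) → 498 ≤ parts 5 n n
498≤parts-medium n n≥ n≤ with oddRemainder n n≥ n≤
... | k , m , refl , 1≤k , m≥ , m< , odd , m<k² = begin
  498                         ≤⟨ 498≤parts₄ m k m≥ m< odd m<k² ⟩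
  parts 4 k m                 ≡⟨ shift-+ˡ (k * k) (parts 4 k) m ⟨
  withLargest 4 k (k * k + m) ≤⟨ withLargest≤parts 4 (k * k + m) 1≤k (≤-trans (m≤m*n k k {{>-nonZero 1≤k}}) (m≤m+n (k * k) m)) ⟩
  parts 5 (k * k + m) (k * k + m) ∎
  where open ≤-Reasoning

-- Small n and the conclusion

forbidden : List ℕ
forbidden = 259 ∷ 304 ∷ 308 ∷ 372 ∷ 394 ∷ 483 ∷ 497 ∷ []

forbidden<498 : ∀ {m} → m ∈ forbidden → m < 498
forbidden<498 = All.lookup (toWitness {a? = All.all? (_<? 498) forbidden} tt)

allowed : ℕ → ℕ → Bool
allowed _ d = not ⌊ d ∈? forbidden ⌋

allowed⇒∉ : ∀ i d → allowed i d ≡ true → ¬ (d ∈ forbidden)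
allowed⇒∉ i d ok d∈ with d ∈? forbidden
... | no d∉ = d∉ d∈

-- The digits are at most 256⁵ < 2⁴¹, and 65536 = 64 · 2¹⁰.
parts-small : ∀ n → n < 65536 → ¬ (parts 5 256 n ∈ forbidden)
parts-small n n< = allowed⇒∉ n (parts 5 256 n)
  (Packed.Scan.scan-parts₅ 2199023255552 allowed 64 10 256 (<ᵇ⇒< (256 ^ 5) 2199023255552 tt) refl n<)

theorem6p3 : ∀ m → m ∈ (259 ∷ 304 ∷ 308 ∷ 372 ∷ 394 ∷ 483 ∷ 497 ∷ []) →
    ∀ n → p2 (suc n) 5 ≢ m
theorem6p3 m m∈ n p≡m with suc n <? 65536 | n <? 169 * (6474 * 6474)
-- `p2` bounds the bases by `suc n`, the scan by 256; the counts agree since suc n < 65536 ≤ 257².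
... | yes n< | _ = parts-small (suc n) n< (subst (_∈ forbidden) (trans (sym p≡m)
  (parts-bound-irrelevant 4 {suc n} {256} {suc n}
    (<-≤-trans (n<1+n (suc n)) (m≤m*n (suc (suc n)) (suc (suc n))))
    (<-≤-trans n< (≤ᵇ⇒≤ 65536 (257 * 257) tt)))) m∈)
... | no n≮ | yes n< = <⇒≱ (forbidden<498 m∈)
  (subst (498 ≤_) p≡m (498≤parts-medium (suc n) (≮⇒≥ n≮) n<))
... | no _ | no n≮ = <⇒≱ (forbidden<498 m∈) (subst (498 ≤_) p≡m (498≤parts-large n (≮⇒≥ n≮)))
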